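{- Let $n\ge1$, let $G$ be a simple graph on $[n]$, and let $\mathcal{S}_{n,G}$ be the arrangement in $\mathbb{R}^n$ consisting of the hyperplanes $x_i-x_j=0$ for all $1\le i<j\le n$ and $x_i-x_j=1$ for all $1\le i<j\le n$ with $\{i,j\}\in G$. The map $\sigma_{n,G}$ (defined below) is a bijection between the regions of $\mathcal{S}_{n,G}$ and the parking functions $f=(a_1,\ldots,a_n)$ on $[n]$ satisfying the following condition: for every $i$, if there exists $j>i$ with $a_i=a_j$ and $j$ is the smallest such integer, then $\{i,j\}\in G$.
   Context: A region of an arrangement is a connected component of the complement of the union of its hyperplanes. A parking function on $[n]$ is a map $f:[n]\to[n]$, written $(a_1,\ldots,a_n)$ with $a_i=f(i)$, such that $|f^{ -1}(\{1,\ldots,j\})|\ge j$ for all $1\le j\le n$. For a region $R$ of $\mathcal{S}_{n,G}$, let $w=w_1\cdots w_n$ be the unique permutation of $[n]$ with $x_{w_1}>\cdots>x_{w_n}$ on $R$; the position of $m$ is the index $p$ with $w_p=m$. Draw an arc from $i$ to $j$ whenever $i<j$, $\{i,j\}\in G$, and $x_i-x_j>1$ holds on $R$. Then remove every arc $(i,l)$ for which there is a different arc $(j,k)$ with $i$ weakly left of $j$ and $k$ weakly left of $l$ in $w$. The remaining arcs partition $[n]$ into chains (connected components) of increasing integers. The map $\sigma_{n,G}$ sends $R$ to $f$ with $f(i)$ equal to the position in $w$ of the leftmost element of the chain containing $i$. -}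

module Defs where

open import Level using (0ℓ) renaming (suc to lsuc)
open import Data.Nat as ℕ using (ℕ; _⊔_)
import Data.Nat.Properties as ℕ
open import Data.Fin using (Fin; toℕ; _<_; _≤_)
open import Data.Fin.Permutation using (Permutation′; _⟨$⟩ʳ_; _⟨$⟩ˡ_)
open import Data.List using (length; filter; allFin)
open import Data.Rational as ℚ using (ℚ; 0ℚ; 1ℚ; ½; ∣_∣)
import Data.Rational.Properties as ℚ
open import Data.Rational.Solver using (module +-*-Solver)
open import Data.Product using (Σ-syntax; ∃-syntax; _×_; _,_; proj₁; proj₂)
open import Data.Sum using (_⊎_; inj₁; inj₂)
open import Relation.Nullary using (¬_)
open import Relation.Unary using (Pred; _∈_; _⊆_; _∪_; _∩_; Empty; Satisfiable)
open import Relation.Binary using (Rel; Setoid; Symmetric; Irreflexive; Decidable)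
open import Relation.Binary.PropositionalEquality
  using (_≡_; _≢_; _≗_; refl; sym; trans; cong; subst)
open import Relation.Binary.Construct.Closure.Equivalence using (EqClosure)

------------------------------------------------------------------------
-- Real numbers: Cauchy sequences of rationals.  Real equality is the
-- complement of _#_ below; no predicate needs it explicitly.

record ℝ : Set where
  constructor mkℝ
  field
    seq    : ℕ → ℚ
    cauchy : ∀ ε → 0ℚ ℚ.< ε → ∃[ N ] ∀ m n → N ℕ.≤ m → N ℕ.≤ n →
             ∣ seq m ℚ.- seq n ∣ ℚ.< ε

open ℝ public

fromℚ : ℚ → ℝ
fromℚ q = mkℝ (λ _ → q) λ ε 0<ε → 0 , λ _ _ _ _ →
  subst (λ d → ∣ d ∣ ℚ.< ε) (sym (ℚ.+-inverseʳ q)) 0<ε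

0ℝ 1ℝ : ℝ
0ℝ = fromℚ 0ℚ
1ℝ = fromℚ 1ℚ

infixl 6 _-_
infix  4 _<ℝ_ _#_

_-_ : ℝ → ℝ → ℝ
x - y = mkℝ (λ n → seq x n ℚ.- seq y n) λ ε 0<ε →
  let 0<½ε      = ℚ.*-monoʳ-<-pos ½ 0<ε
      (M , x-M) = cauchy x (½ ℚ.* ε) 0<½ε
      (N , y-N) = cauchy y (½ ℚ.* ε) 0<½ε
  in M ⊔ N , λ m n M⊔N≤m M⊔N≤n →
     bound (seq x m) (seq x n) (seq y m) (seq y n) ε
       (x-M m n (ℕ.m⊔n≤o⇒m≤o M N M⊔N≤m) (ℕ.m⊔n≤o⇒m≤o M N M⊔N≤n))
       (y-N m n (ℕ.m⊔n≤o⇒n≤o M N M⊔N≤m) (ℕ.m⊔n≤o⇒n≤o M N M⊔N≤n))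
  where
  open +-*-Solver

  rearrange : ∀ a b c d → (a ℚ.- c) ℚ.- (b ℚ.- d) ≡ (a ℚ.- b) ℚ.- (c ℚ.- d)
  rearrange = solve 4
    (λ a b c d → (a :- c) :- (b :- d) := (a :- b) :- (c :- d)) refl

  halves : ∀ ε → ½ ℚ.* ε ℚ.+ ½ ℚ.* ε ≡ ε
  halves ε = trans (sym (ℚ.*-distribʳ-+ ε ½ ½)) (ℚ.*-identityˡ ε)

  bound : ∀ a b c d ε → ∣ a ℚ.- b ∣ ℚ.< ½ ℚ.* ε → ∣ c ℚ.- d ∣ ℚ.< ½ ℚ.* ε →
          ∣ (a ℚ.- c) ℚ.- (b ℚ.- d) ∣ ℚ.< ε
  bound a b c d ε ab cd = begin-strict
    ∣ (a ℚ.- c) ℚ.- (b ℚ.- d) ∣     ≡⟨ cong ∣_∣ (rearrange a b c d) ⟩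
    ∣ (a ℚ.- b) ℚ.- (c ℚ.- d) ∣     ≤⟨ ℚ.∣p-q∣≤∣p∣+∣q∣ (a ℚ.- b) (c ℚ.- d) ⟩
    ∣ a ℚ.- b ∣ ℚ.+ ∣ c ℚ.- d ∣     <⟨ ℚ.+-mono-< ab cd ⟩
    ½ ℚ.* ε ℚ.+ ½ ℚ.* ε             ≡⟨ halves ε ⟩
    ε                               ∎
    where open ℚ.≤-Reasoning

_<ℝ_ : Rel ℝ 0ℓ
x <ℝ y = ∃[ ε ] 0ℚ ℚ.< ε × ∃[ N ] ∀ n → N ℕ.≤ n → seq x n ℚ.+ ε ℚ.< seq y n

-- Apartness: the constructive reading of x ≠ y (classically the same).
_#_ : Rel ℝ 0ℓ
x # y = x <ℝ y ⊎ y <ℝ x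

------------------------------------------------------------------------
-- Topology of ℝⁿ.  Open sets are automatically invariant under equality
-- of reals, so connectedness does not depend on whether a set of
-- representatives is closed under it.

ℝ^ : ℕ → Set
ℝ^ n = Fin n → ℝ

Ball : ∀ {n} → ℝ^ n → ℝ → Pred (ℝ^ n) 0ℓ
Ball x ε y = ∀ i → (x i - y i <ℝ ε) × (y i - x i <ℝ ε)

Open : ∀ {n} → Pred (ℝ^ n) 0ℓ → Set
Open U = ∀ x → x ∈ U → ∃[ ε ] (0ℝ <ℝ ε) × (Ball x ε ⊆ U)

Connected : ∀ {n} → Pred (ℝ^ n) 0ℓ → Set₁
Connected {n} C = ∀ (U V : Pred (ℝ^ n) 0ℓ) → Open U → Open V → C ⊆ U ∪ V →
  Satisfiable (C ∩ U) → Satisfiable (C ∩ V) → ¬ Empty (C ∩ (U ∩ V))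

-- y lies in the connected component of x in the subspace X.
InComponent : ∀ {n} → Pred (ℝ^ n) 0ℓ → ℝ^ n → ℝ^ n → Set₁
InComponent {n} X x y =
  Σ[ C ∈ Pred (ℝ^ n) 0ℓ ] C ⊆ X × Connected C × x ∈ C × y ∈ C

------------------------------------------------------------------------
-- Arrangements of hyperplanes of the form xᵢ − xⱼ = c, and their regions

record Hyperplane (n : ℕ) : Set where
  constructor hyperplane
  field
    i j : Fin n
    c   : ℝ

Arrangement : ℕ → Set₁
Arrangement n = Pred (Hyperplane n) 0ℓ

Complement : ∀ {n} → Arrangement n → Pred (ℝ^ n) 0ℓ
Complement 𝒜 x = ∀ {i j c} → hyperplane i j c ∈ 𝒜 → (x i - x j) # c

-- A region is given by any of its points; two such presentations are
-- equal when the points lie in the same connected component.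
Region : ∀ {n} → Arrangement n → Set
Region {n} 𝒜 = Σ[ x ∈ ℝ^ n ] x ∈ Complement 𝒜

points : ∀ {n} {𝒜 : Arrangement n} → Region 𝒜 → Pred (ℝ^ n) (lsuc 0ℓ)
points {𝒜 = 𝒜} (x , _) y = InComponent (Complement 𝒜) x y

regionSetoid : ∀ {n} → Arrangement n → Setoid 0ℓ (lsuc 0ℓ)
regionSetoid {n} 𝒜 = record
  { Carrier       = Region 𝒜
  ; _≈_           = λ R S → proj₁ S ∈ points R
  ; isEquivalence = record
    { refl  = λ {R} → singleton R
    ; sym   = λ { (C , C⊆ , conn , x∈C , y∈C) → C , C⊆ , conn , y∈C , x∈C }
    ; trans = union
    }
  }
  where
  singleton : ∀ (R : Region 𝒜) → proj₁ R ∈ points R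
  singleton (x , x∈) = (_≡ x) , (λ { refl → x∈ }) , connected , refl , refl
    where
    connected : Connected (_≡ x)
    connected U V _ _ _ (_ , refl , x∈U) (_ , refl , x∈V) empty =
      empty x (refl , x∈U , x∈V)

  union : ∀ {x y z} → InComponent (Complement 𝒜) x y →
          InComponent (Complement 𝒜) y z → InComponent (Complement 𝒜) x z
  union {x} {y} {z} (C , C⊆ , C-conn , x∈C , y∈C) (D , D⊆ , D-conn , y∈D , z∈D) =
    C ∪ D , (λ { (inj₁ p) → C⊆ p ; (inj₂ p) → D⊆ p }) , connected , inj₁ x∈C , inj₂ z∈D
    where
    connected : Connected (C ∪ D)
    connected U V oU oV cover (a , a∈ , a∈U) (b , b∈ , b∈V) empty =
      go a∈ b∈ (cover (inj₁ y∈C))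
      where
      inC : Satisfiable (C ∩ U) → Satisfiable (C ∩ V) → _
      inC p q = C-conn U V oU oV (λ r → cover (inj₁ r)) p q
        λ w (w∈C , w∈UV) → empty w (inj₁ w∈C , w∈UV)
      inD : Satisfiable (D ∩ U) → Satisfiable (D ∩ V) → _
      inD p q = D-conn U V oU oV (λ r → cover (inj₂ r)) p q
        λ w (w∈D , w∈UV) → empty w (inj₂ w∈D , w∈UV)
      go : a ∈ C ∪ D → b ∈ C ∪ D → y ∈ U ∪ V → _
      go (inj₁ a∈C) (inj₁ b∈C) _          = inC (a , a∈C , a∈U) (b , b∈C , b∈V)
      go (inj₂ a∈D) (inj₂ b∈D) _          = inD (a , a∈D , a∈U) (b , b∈D , b∈V)
      go (inj₁ _)   (inj₂ b∈D) (inj₁ y∈U) = inD (y , y∈D , y∈U) (b , b∈D , b∈V)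
      go (inj₁ a∈C) (inj₂ _)   (inj₂ y∈V) = inC (a , a∈C , a∈U) (y , y∈C , y∈V)
      go (inj₂ _)   (inj₁ b∈C) (inj₁ y∈U) = inC (y , y∈C , y∈U) (b , b∈C , b∈V)
      go (inj₂ a∈D) (inj₁ _)   (inj₂ y∈V) = inD (a , a∈D , a∈U) (y , y∈D , y∈V)

------------------------------------------------------------------------
-- Graphs and the arrangement 𝒮.  Throughout, [n] is Fin n, so vertices,
-- positions and values of parking functions are numbered from 0.

record SimpleGraph (n : ℕ) : Set₁ where
  field
    Adj    : Rel (Fin n) 0ℓ
    symm   : Symmetric Adj
    irrefl : Irreflexive _≡_ Adj
    adj?   : Decidable Adj

open SimpleGraph public

data 𝒮 {n : ℕ} (G : SimpleGraph n) : Arrangement n where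
  braid : ∀ {i j} → i < j → hyperplane i j 0ℝ ∈ 𝒮 G
  shi   : ∀ {i j} → i < j → Adj G i j → hyperplane i j 1ℝ ∈ 𝒮 G

------------------------------------------------------------------------
-- Parking functions

-- The values 1,…,j are those with toℕ a < j in the numbering from 0.
IsParkingFunction : ∀ {n} → Pred (Fin n → Fin n) 0ℓ
IsParkingFunction {n} f = ∀ j → 1 ℕ.≤ j → j ℕ.≤ n →
  j ℕ.≤ length (filter (λ i → toℕ (f i) ℕ.<? j) (allFin n))

NextEqual : ∀ {n} → (Fin n → Fin n) → Fin n → Fin n → Set
NextEqual f i j =
  i < j × f i ≡ f j × (∀ k → i < k → f i ≡ f k → j ≤ k)

Compatible : ∀ {n} → SimpleGraph n → Pred (Fin n → Fin n) 0ℓ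
Compatible G f = ∀ i j → NextEqual f i j → Adj G i j

ParkingFunction : ∀ {n} → SimpleGraph n → Set
ParkingFunction {n} G =
  Σ[ f ∈ (Fin n → Fin n) ] IsParkingFunction f × Compatible G f

parkingSetoid : ∀ {n} → SimpleGraph n → Setoid 0ℓ 0ℓ
parkingSetoid {n} G = record
  { Carrier       = ParkingFunction G
  ; _≈_           = λ f g → proj₁ f ≗ proj₁ g
  ; isEquivalence = record
    { refl  = λ _ → refl
    ; sym   = λ p i → sym (p i)
    ; trans = λ p q i → trans (p i) (q i)
    }
  }

------------------------------------------------------------------------
-- The map σ

module _ {n : ℕ} (G : SimpleGraph n) (R : Region (𝒮 G)) where

  HoldsOnRegion : Pred (ℝ^ n) 0ℓ → Set₁
  HoldsOnRegion P = ∀ x → x ∈ points R → x ∈ P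

  -- w ⟨$⟩ʳ p is the entry w_p, and w ⟨$⟩ˡ m is the position of m.
  SortedBy : Permutation′ n → Set₁
  SortedBy w = ∀ p q → p < q →
    HoldsOnRegion (λ x → x (w ⟨$⟩ʳ q) <ℝ x (w ⟨$⟩ʳ p))

  Arc : Fin n → Fin n → Set₁
  Arc i j = i < j × Adj G i j × HoldsOnRegion (λ x → 1ℝ <ℝ x i - x j)

  module _ (w : Permutation′ n) where

    WeaklyLeft : Rel (Fin n) 0ℓ
    WeaklyLeft i j = (w ⟨$⟩ˡ i) ≤ (w ⟨$⟩ˡ j)

    Removed : Fin n → Fin n → Set₁
    Removed i l = ∃[ j ] ∃[ k ]
      Arc j k × (j , k) ≢ (i , l) × WeaklyLeft i j × WeaklyLeft k l

    RemainingArc : Rel (Fin n) (lsuc 0ℓ)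
    RemainingArc i l = Arc i l × ¬ Removed i l

    SameChain : Rel (Fin n) (lsuc 0ℓ)
    SameChain = EqClosure RemainingArc

    LeftmostInChain : Fin n → Fin n → Set₁
    LeftmostInChain i m = SameChain i m × (∀ k → SameChain i k → WeaklyLeft m k)

  -- The graph of the map σ: this says that σ sends R to f.
  σ-Graph : Pred (Fin n → Fin n) (lsuc 0ℓ)
  σ-Graph f = Σ[ w ∈ Permutation′ n ] SortedBy w ×
    (∀ i → ∃[ m ] LeftmostInChain w i m × f i ≡ w ⟨$⟩ˡ m)

{-# OPTIONS --safe #-}

-- Two points of the complement of an arrangement lie in the same region iff they
-- lie on the same side of every hyperplane: half-spaces are open, and conversely a
-- convex set is connected, by bisecting a segment.  A region of 𝒮 G is therefore
-- the order w of the coordinates together with the set of arcs.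
--
-- An arc is exactly a pair i < l adjacent in G whose interval in w contains a
-- remaining arc, so the remaining arcs determine all arcs.  They join consecutive
-- elements of the fibres of f = σ R, and as they do not nest, w is read off f from
-- left to right with a queue: position p receives the least element of f⁻¹(p) if p
-- is a value of f, and otherwise the successor of the earliest element whose
-- successor is still missing.  This proves injectivity.
--
-- Conversely the parking condition says that this queue never runs dry, and the
-- resulting word with its non-nesting arcs is a semiorder, which is realised by
-- choosing the coordinates one at a time from left to right.
module Submission where

open import Defs
open import Level using (0ℓ)
open import Data.Nat as ℕ using (ℕ; zero; suc; _⊔_; _≤_)
import Data.Nat.Induction as ℕ
import Data.Nat.Properties as ℕ
open import Data.Integer as ℤ using (+_)
import Data.Integer.Properties as ℤ
open import Data.Rational as ℚ using (ℚ; 0ℚ; 1ℚ; ½; ∣_∣; ↥_; ↧_; toℚᵘ)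
import Data.Rational.Properties as ℚ
open import Data.Rational.Solver using (module +-*-Solver)
import Data.Rational.Unnormalised as ℚᵘ
import Data.Rational.Unnormalised.Properties as ℚᵘ
open import Data.Fin as Fin using (Fin; zero; suc; toℕ; fromℕ<; punchOut; _<_)
import Data.Fin.Induction as Fin
open import Data.Fin.Permutation using (Permutation′; permutation; flip; _⟨$⟩ʳ_; _⟨$⟩ˡ_; inverseˡ; inverseʳ)
import Data.Fin.Properties as Fin
open import Data.Fin.Subset as Subset using (Subset; _⊂_)
import Data.Fin.Subset.Properties as Subset
open import Data.List as List using (List; []; _∷_; _++_; allFin; filter; length; map; upTo)
open import Data.List.Membership.Propositional using () renaming (_∈_ to _∈ˡ_)
open import Data.List.Membership.Propositional.Properties
open import Data.List.Relation.Unary.All as All using (All; []; _∷_)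
open import Data.List.Relation.Unary.AllPairs using (_∷_)
open import Data.List.Relation.Unary.Any using (index)
import Data.List.Relation.Unary.Any.Properties as Any
open import Data.List.Relation.Unary.Unique.Propositional using (Unique)
import Data.List.Relation.Unary.Unique.Propositional.Properties as Unique
import Data.Vec as Vec
import Data.Vec.Properties as Vec
open import Data.Empty using (⊥)
open import Data.Product using (Σ-syntax; ∃-syntax; _×_; _,_; proj₁; proj₂)
open import Data.Product.Properties using (≡-dec; ,-injectiveˡ; ,-injectiveʳ)
open import Data.Sum using (_⊎_; inj₁; inj₂; [_,_]′)
open import Function using (_∘_; id; Injective; mk⇔)
open import Function.Bundles using (Bijection; _⇔_)
open import Induction.WellFounded using (Acc; acc)
open import Relation.Nullary using (¬_; ¬?; Dec; yes; no; does; contradiction)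
open import Relation.Nullary.Decidable using (_×-dec_; _→-dec_; dec-true)
open import Relation.Unary using (Pred; Decidable; _∈_; _⊆_; _∪_; _∩_; Empty; Satisfiable)
import Relation.Binary as B
open import Relation.Binary using (Rel; Setoid; tri<; tri≈; tri>)
import Relation.Binary.Construct.Closure.Equivalence as Eq
open import Relation.Binary.Construct.Closure.ReflexiveTransitive using (Star; _◅_; _◅◅_) renaming (ε to stop)
open import Relation.Binary.Construct.Closure.Symmetric using (fwd; bwd)
open import Relation.Binary.PropositionalEquality
open +-*-Solver using (solve; _:+_; _:*_; _:-_; :-_; _:=_; con)

-- Linear arithmetic over ℚ

-- The argument is constructive, and inequalities between Cauchy reals are not decidable. What
-- rescues the combinatorics is that a point of the complement carries, for every hyperplane, a
-- witness of the side on which it lies. The order of its coordinates and the relation `Arc`,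
-- although the latter quantifies over a whole region, can therefore be decided at one point, and
-- sorting, removal and chains become finite computations. Likewise a cover `C ⊆ U ∪ V` is a
-- function into a disjoint union, so bisection can ask it about every midpoint. `Queue` records
-- what the words of regions and the words built from parking functions have in common, and
-- `NextEqual` pairs stand for remaining arcs on both sides; injectivity and surjectivity rest on
-- these two notions. The realising point is rational because fitting a number between finitely many
-- bounds uses a decidable comparison.

gap : ∀ {p q} → p ℚ.< q → 0ℚ ℚ.< q ℚ.- p
gap {p} {q} p<q = subst (ℚ._< q ℚ.- p) (ℚ.+-inverseʳ p) (ℚ.+-monoˡ-< (ℚ.- p) p<q)

ungap : ∀ {p q} → 0ℚ ℚ.< q ℚ.- p → p ℚ.< q
ungap {p} {q} 0<q-p = subst₂ ℚ._<_ (ℚ.+-identityˡ p)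
  (solve 2 (λ p q → (q :- p) :+ p := q) refl p q) (ℚ.+-monoˡ-< p 0<q-p)

-- The ring solver proves identities only, so a strict inequality is derived by exhibiting its gap q
-- - p as a sum of gaps of known inequalities.
linear₁ : ∀ {p q p₁ q₁} → p₁ ℚ.< q₁ → q ℚ.- p ≡ q₁ ℚ.- p₁ → p ℚ.< q
linear₁ lt eq = ungap (subst (0ℚ ℚ.<_) (sym eq) (gap lt))

linear₂ : ∀ {p q p₁ q₁ p₂ q₂} → p₁ ℚ.< q₁ → p₂ ℚ.< q₂ →
          q ℚ.- p ≡ (q₁ ℚ.- p₁) ℚ.+ (q₂ ℚ.- p₂) → p ℚ.< q
linear₂ lt₁ lt₂ eq =
  ungap (subst (0ℚ ℚ.<_) (sym eq) (ℚ.+-mono-< (gap lt₁) (gap lt₂)))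

linear₃ : ∀ {p q p₁ q₁ p₂ q₂ p₃ q₃} → p₁ ℚ.< q₁ → p₂ ℚ.< q₂ → p₃ ℚ.< q₃ →
          q ℚ.- p ≡ ((q₁ ℚ.- p₁) ℚ.+ (q₂ ℚ.- p₂)) ℚ.+ (q₃ ℚ.- p₃) → p ℚ.< q
linear₃ lt₁ lt₂ lt₃ eq =
  ungap (subst (0ℚ ℚ.<_) (sym eq) (ℚ.+-mono-< (ℚ.+-mono-< (gap lt₁) (gap lt₂)) (gap lt₃)))

0<1 : 0ℚ ℚ.< 1ℚ
0<1 = ℚ.positive⁻¹ 1ℚ

0<½* : ∀ {ε} → 0ℚ ℚ.< ε → 0ℚ ℚ.< ½ ℚ.* ε
0<½* = ℚ.*-monoʳ-<-pos ½

½+½ : ∀ ε → ½ ℚ.* ε ℚ.+ ½ ℚ.* ε ≡ ε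
½+½ ε = trans (sym (ℚ.*-distribʳ-+ ε ½ ½)) (ℚ.*-identityˡ ε)

⊓-pos : ∀ {p q} → 0ℚ ℚ.< p → 0ℚ ℚ.< q → 0ℚ ℚ.< p ℚ.⊓ q
⊓-pos {p} {q} 0<p 0<q with ℚ.⊓-sel p q
... | inj₁ eq = subst (0ℚ ℚ.<_) (sym eq) 0<p
... | inj₂ eq = subst (0ℚ ℚ.<_) (sym eq) 0<q

p≤∣p∣ : ∀ p → p ℚ.≤ ∣ p ∣
p≤∣p∣ p with ℚ.≤-total 0ℚ p
... | inj₁ 0≤p = ℚ.≤-reflexive (sym (ℚ.0≤p⇒∣p∣≡p 0≤p))
... | inj₂ p≤0 = ℚ.≤-trans p≤0 (ℚ.0≤∣p∣ p)

-p≤∣p∣ : ∀ p → ℚ.- p ℚ.≤ ∣ p ∣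
-p≤∣p∣ p = subst (ℚ.- p ℚ.≤_) (ℚ.∣-p∣≡∣p∣ p) (p≤∣p∣ (ℚ.- p))

∣∣<⁺ : ∀ {p e} → p ℚ.< e → ℚ.- p ℚ.< e → ∣ p ∣ ℚ.< e
∣∣<⁺ {p} {e} p<e -p<e with ℚ.∣p∣≡p∨∣p∣≡-p p
... | inj₁ eq = subst (ℚ._< e) (sym eq) p<e
... | inj₂ eq = subst (ℚ._< e) (sym eq) -p<e

∣∣≤⁺ : ∀ {p e} → p ℚ.≤ e → ℚ.- p ℚ.≤ e → ∣ p ∣ ℚ.≤ e
∣∣≤⁺ {p} {e} p≤e -p≤e with ℚ.∣p∣≡p∨∣p∣≡-p p
... | inj₁ eq = subst (ℚ._≤ e) (sym eq) p≤e
... | inj₂ eq = subst (ℚ._≤ e) (sym eq) -p≤e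

p-q≤r : ∀ {p q r} → p ℚ.≤ q ℚ.+ r → p ℚ.- q ℚ.≤ r
p-q≤r {p} {q} {r} le = subst (p ℚ.- q ℚ.≤_)
  (solve 2 (λ q r → (q :+ r) :- q := r) refl q r) (ℚ.+-monoˡ-≤ (ℚ.- q) le)

-- Powers of ½

half^ : ℕ → ℚ
half^ zero    = 1ℚ
half^ (suc k) = ½ ℚ.* half^ k

half^-pos : ∀ k → 0ℚ ℚ.< half^ k
half^-pos zero    = 0<1
half^-pos (suc k) = 0<½* (half^-pos k)

half^-nonNeg : ∀ k → ℚ.NonNegative (half^ k)
half^-nonNeg k = ℚ.nonNegative (ℚ.<⇒≤ (half^-pos k))

half^-split : ∀ k → half^ (suc k) ℚ.+ half^ (suc k) ≡ half^ k
half^-split k = ½+½ (half^ k)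

half^-suc-≤ : ∀ k → half^ (suc k) ℚ.≤ half^ k
half^-suc-≤ k = subst₂ ℚ._≤_ (ℚ.+-identityʳ _) (half^-split k)
  (ℚ.+-monoʳ-≤ (half^ (suc k)) (ℚ.<⇒≤ (half^-pos (suc k))))

half^-anti : ∀ {k l} → k ℕ.≤′ l → half^ l ℚ.≤ half^ k
half^-anti ℕ.≤′-refl              = ℚ.≤-refl
half^-anti {k} (ℕ.≤′-step {l} le) = ℚ.≤-trans (half^-suc-≤ l) (half^-anti le)

fromℕ : ℕ → ℚ
fromℕ zero    = 0ℚ
fromℕ (suc n) = 1ℚ ℚ.+ fromℕ n

toℚᵘ-fromℕ : ∀ n → toℚᵘ (fromℕ n) ℚᵘ.≃ ℚᵘ.mkℚᵘ (+ n) 0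
toℚᵘ-fromℕ zero    = ℚᵘ.≃-refl
toℚᵘ-fromℕ (suc n) = ℚᵘ.≃-trans (ℚ.toℚᵘ-homo-+ 1ℚ (fromℕ n))
  (ℚᵘ.≃-trans (ℚᵘ.+-congʳ ℚᵘ.1ℚᵘ (toℚᵘ-fromℕ n))
    (ℚᵘ.*≡* (cong (λ i → (+ 1 ℤ.+ i) ℤ.* + 1) (ℤ.*-identityʳ (+ n)))))

-- A denominator is at least 1, so the numerator alone bounds p.
p≤fromℕ∣↥p∣ : ∀ p → p ℚ.≤ fromℕ ℤ.∣ ↥ p ∣
p≤fromℕ∣↥p∣ p@(ℚ.mkℚ _ _ _) = ℚ.toℚᵘ-cancel-≤
  (ℚᵘ.≤-respʳ-≃ (ℚᵘ.≃-sym (toℚᵘ-fromℕ ℤ.∣ ↥ p ∣)) (ℚᵘ.*≤* (le (↥ p))))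
  where
  le : ∀ i → i ℤ.* + 1 ℤ.≤ + ℤ.∣ i ∣ ℤ.* ↧ p
  le i = ℤ.≤-trans (ℤ.≤-reflexive (ℤ.*-identityʳ i)) (ℤ.≤-trans (i≤∣i∣ i)
    (subst (+ ℤ.∣ i ∣ ℤ.≤_) (ℤ.pos-* ℤ.∣ i ∣ (suc (ℚ.denominator-1 p)))
      (ℤ.+≤+ (ℕ.m≤m*n ℤ.∣ i ∣ (suc (ℚ.denominator-1 p))))))
    where
    i≤∣i∣ : ∀ i → i ℤ.≤ + ℤ.∣ i ∣
    i≤∣i∣ (+ n)      = ℤ.≤-refl
    i≤∣i∣ ℤ.-[1+ n ] = ℤ.-≤+

half^*fromℕ<1 : ∀ n → half^ n ℚ.* fromℕ n ℚ.< 1ℚ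
half^*fromℕ<1 zero    = subst (ℚ._< 1ℚ) (sym (ℚ.*-zeroʳ 1ℚ)) 0<1
half^*fromℕ<1 (suc n) = begin-strict
  (½ ℚ.* h) ℚ.* (1ℚ ℚ.+ m)        ≡⟨ expand ½ h m ⟩
  ½ ℚ.* h ℚ.+ ½ ℚ.* (h ℚ.* m)     ≤⟨ ℚ.+-monoˡ-≤ _ (ℚ.*-monoˡ-≤-nonNeg ½ (half^-anti {0} {n} (ℕ.≤⇒≤′ ℕ.z≤n))) ⟩
  ½ ℚ.* 1ℚ ℚ.+ ½ ℚ.* (h ℚ.* m)    <⟨ ℚ.+-monoʳ-< (½ ℚ.* 1ℚ) (ℚ.*-monoʳ-<-pos ½ (half^*fromℕ<1 n)) ⟩
  ½ ℚ.* 1ℚ ℚ.+ ½ ℚ.* 1ℚ           ≡⟨ ½+½ 1ℚ ⟩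
  1ℚ                              ∎
  where
  open ℚ.≤-Reasoning
  h = half^ n
  m = fromℕ n
  expand : ∀ a h m → (a ℚ.* h) ℚ.* (1ℚ ℚ.+ m) ≡ a ℚ.* h ℚ.+ a ℚ.* (h ℚ.* m)
  expand = solve 3 (λ a h m → (a :* h) :* (con 1ℚ :+ m) := a :* h :+ a :* (h :* m)) refl

opaque
  -- The Archimedean property. The absolute numerator of B/ε is an integer above B/ε, and with this
  -- integer as exponent K the estimate `half^*fromℕ<1` gives half^ K * (B/ε) < 1.
  half^-vanishes : ∀ B ε → 0ℚ ℚ.≤ B → 0ℚ ℚ.< ε →
                   ∃[ K ] ∀ k → K ℕ.≤ k → half^ k ℚ.* B ℚ.< ε
  half^-vanishes B ε 0≤B 0<ε = K , λ k K≤k → begin-strict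
    half^ k ℚ.* B           ≤⟨ ℚ.*-monoʳ-≤-nonNeg B {{ℚ.nonNegative 0≤B}} (half^-anti (ℕ.≤⇒≤′ K≤k)) ⟩
    half^ K ℚ.* B           ≡⟨ cong (half^ K ℚ.*_) B≡q*ε ⟩
    half^ K ℚ.* (q ℚ.* ε)   ≡⟨ ℚ.*-assoc (half^ K) q ε ⟨
    (half^ K ℚ.* q) ℚ.* ε   <⟨ ℚ.*-monoˡ-<-pos ε half^K*q<1 ⟩
    1ℚ ℚ.* ε                ≡⟨ ℚ.*-identityˡ ε ⟩
    ε                       ∎
    where
    open ℚ.≤-Reasoning
    instance
      ε-pos : ℚ.Positive ε
      ε-pos = ℚ.positive 0<ε
      ε≢0 : ℚ.NonZero ε
      ε≢0 = ℚ.pos⇒nonZero ε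
    q : ℚ
    q = B ℚ.* ℚ.1/ ε
    K : ℕ
    K = ℤ.∣ ↥ q ∣
    half^K*q<1 : half^ K ℚ.* q ℚ.< 1ℚ
    half^K*q<1 = ℚ.≤-<-trans
      (ℚ.*-monoˡ-≤-nonNeg (half^ K) {{half^-nonNeg K}} (p≤fromℕ∣↥p∣ q)) (half^*fromℕ<1 K)
    B≡q*ε : B ≡ q ℚ.* ε
    B≡q*ε = sym (trans (ℚ.*-assoc B (ℚ.1/ ε) ε)
      (trans (cong (B ℚ.*_) (ℚ.*-inverseˡ ε)) (ℚ.*-identityʳ B)))

-- The order on ℝ

<ℝ-asym : ∀ {x y} → x <ℝ y → ¬ (y <ℝ x)
<ℝ-asym {x} {y} (ε , 0<ε , M , x<y) (δ , 0<δ , N , y<x) =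
  ℚ.<-asym (ℚ.+-mono-< 0<ε 0<δ) (linear₂
    (x<y (M ⊔ N) (ℕ.m≤m⊔n M N)) (y<x (M ⊔ N) (ℕ.m≤n⊔m M N))
    (solve 4 (λ a b e d → (con 0ℚ :+ con 0ℚ) :- (e :+ d) := (b :- (a :+ e)) :+ (a :- (b :+ d)))
      refl (seq x (M ⊔ N)) (seq y (M ⊔ N)) ε δ))

<ℝ-trans : ∀ {x y z} → x <ℝ y → y <ℝ z → x <ℝ z
<ℝ-trans {x} {y} {z} (ε , 0<ε , M , x<y) (δ , 0<δ , N , y<z) =
  ε ℚ.+ δ , ℚ.+-mono-< 0<ε 0<δ , M ⊔ N , λ n le → linear₂
    (x<y n (ℕ.m⊔n≤o⇒m≤o M N le)) (y<z n (ℕ.m⊔n≤o⇒n≤o M N le))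
    (solve 5 (λ a b c e d → c :- (a :+ (e :+ d)) := (b :- (a :+ e)) :+ (c :- (b :+ d)))
      refl (seq x n) (seq y n) (seq z n) ε δ)

x-y<0⇒x<y : ∀ {x y} → x - y <ℝ 0ℝ → x <ℝ y
x-y<0⇒x<y {x} {y} (ε , 0<ε , N , lt) = ε , 0<ε , N , λ n le → linear₁ (lt n le)
  (solve 3 (λ a b e → b :- (a :+ e) := con 0ℚ :- ((a :- b) :+ e)) refl (seq x n) (seq y n) ε)

x<y⇒x-y<0 : ∀ {x y} → x <ℝ y → x - y <ℝ 0ℝ
x<y⇒x-y<0 {x} {y} (ε , 0<ε , N , lt) = ε , 0<ε , N , λ n le → linear₁ (lt n le)
  (solve 3 (λ a b e → con 0ℚ :- ((a :- b) :+ e) := b :- (a :+ e)) refl (seq x n) (seq y n) ε)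

0<x-y⇒y<x : ∀ {x y} → 0ℝ <ℝ x - y → y <ℝ x
0<x-y⇒y<x {x} {y} (ε , 0<ε , N , lt) = ε , 0<ε , N , λ n le → linear₁ (lt n le)
  (solve 3 (λ a b e → a :- (b :+ e) := (a :- b) :- (con 0ℚ :+ e)) refl (seq x n) (seq y n) ε)

y<x⇒0<x-y : ∀ {x y} → y <ℝ x → 0ℝ <ℝ x - y
y<x⇒0<x-y {x} {y} (ε , 0<ε , N , lt) = ε , 0<ε , N , λ n le → linear₁ (lt n le)
  (solve 3 (λ a b e → (a :- b) :- (con 0ℚ :+ e) := a :- (b :+ e)) refl (seq x n) (seq y n) ε)

0ℝ<1ℝ : 0ℝ <ℝ 1ℝ
0ℝ<1ℝ = ½ , ℚ.positive⁻¹ ½ , 0 , λ _ _ → subst (ℚ._< 1ℚ) (sym (ℚ.+-identityˡ ½))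
  (ℚ.toℚᵘ-cancel-< (ℚᵘ.*<* (ℤ.+<+ (ℕ.s≤s (ℕ.s≤s ℕ.z≤n)))))

1<x-y⇒y<x : ∀ {x y} → 1ℝ <ℝ x - y → y <ℝ x
1<x-y⇒y<x {x} {y} 1<x-y =
  0<x-y⇒y<x {x} {y} (<ℝ-trans {0ℝ} {1ℝ} {x - y} 0ℝ<1ℝ 1<x-y)

<-minus-monoˡ : ∀ {c x y z} → c <ℝ x - z → x <ℝ y → c <ℝ y - z
<-minus-monoˡ {c} {x} {y} {z} (ε , 0<ε , M , lt) (δ , 0<δ , N , x<y) =
  ε ℚ.+ δ , ℚ.+-mono-< 0<ε 0<δ , M ⊔ N , λ n le → linear₂
    (lt n (ℕ.m⊔n≤o⇒m≤o M N le)) (x<y n (ℕ.m⊔n≤o⇒n≤o M N le))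
    (solve 6 (λ c x y z e d → (y :- z) :- (c :+ (e :+ d)) :=
        ((x :- z) :- (c :+ e)) :+ (y :- (x :+ d)))
      refl (seq c n) (seq x n) (seq y n) (seq z n) ε δ)

<-minus-monoʳ : ∀ {c x y z} → c <ℝ x - z → y <ℝ z → c <ℝ x - y
<-minus-monoʳ {c} {x} {y} {z} (ε , 0<ε , M , lt) (δ , 0<δ , N , y<z) =
  ε ℚ.+ δ , ℚ.+-mono-< 0<ε 0<δ , M ⊔ N , λ n le → linear₂
    (lt n (ℕ.m⊔n≤o⇒m≤o M N le)) (y<z n (ℕ.m⊔n≤o⇒n≤o M N le))
    (solve 6 (λ c x y z e d → (x :- y) :- (c :+ (e :+ d)) :=
        ((x :- z) :- (c :+ e)) :+ (z :- (y :+ d)))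
      refl (seq c n) (seq x n) (seq y n) (seq z n) ε δ)

fromℚ-mono : ∀ {p q} → p ℚ.< q → fromℚ p <ℝ fromℚ q
fromℚ-mono {p} {q} p<q = ε , 0<½* (gap p<q) , 0 , λ _ _ → linear₁ (0<½* (gap p<q)) eq
  where
  -- The margin in `_<ℝ_` must itself be beaten strictly, so the whole of q - p would be too much.
  ε = ½ ℚ.* (q ℚ.- p)
  eq : q ℚ.- (p ℚ.+ ε) ≡ ε ℚ.- 0ℚ
  eq = trans (solve 3 (λ p q e → q :- (p :+ e) := (q :- p) :- e) refl p q ε)
    (trans (cong (ℚ._- ε) (sym (½+½ (q ℚ.- p))))
      (solve 1 (λ e → (e :+ e) :- e := e :- con 0ℚ) refl ε))

opaque
  bounded : ∀ x → ∃[ B ] 0ℚ ℚ.≤ B × ∃[ N ] ∀ n → N ℕ.≤ n → ∣ seq x n ∣ ℚ.≤ B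
  bounded x = let (N , close) = cauchy x 1ℚ 0<1 in
    1ℚ ℚ.+ ∣ seq x N ∣ , ℚ.+-mono-≤ (ℚ.<⇒≤ 0<1) (ℚ.0≤∣p∣ (seq x N)) , N , λ n N≤n →
    begin
      ∣ seq x n ∣                                  ≡⟨ cong ∣_∣ (solve 2 (λ a b → a := (a :- b) :+ b) refl (seq x n) (seq x N)) ⟩
      ∣ (seq x n ℚ.- seq x N) ℚ.+ seq x N ∣        ≤⟨ ℚ.∣p+q∣≤∣p∣+∣q∣ (seq x n ℚ.- seq x N) (seq x N) ⟩
      ∣ seq x n ℚ.- seq x N ∣ ℚ.+ ∣ seq x N ∣      ≤⟨ ℚ.+-monoˡ-≤ ∣ seq x N ∣ (ℚ.<⇒≤ (close n N N≤n ℕ.≤-refl)) ⟩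
      1ℚ ℚ.+ ∣ seq x N ∣                           ∎
    where open ℚ.≤-Reasoning

-- Segments

lerpℚ : ℚ → ℚ → ℚ → ℚ
lerpℚ t a b = a ℚ.+ t ℚ.* (b ℚ.- a)

-- The value is affine in t, so it is at most its value at t = 1 or at t = 0, according to the sign
-- of b - a.
lerpℚ-< : ∀ {t a b c} → 0ℚ ℚ.≤ t → t ℚ.≤ 1ℚ → a ℚ.< c → b ℚ.< c → lerpℚ t a b ℚ.< c
lerpℚ-< {t} {a} {b} {c} 0≤t t≤1 a<c b<c with ℚ.≤-total a b
... | inj₁ a≤b = ℚ.≤-<-trans (subst (lerpℚ t a b ℚ.≤_)
        (solve 2 (λ a b → a :+ con 1ℚ :* (b :- a) := b) refl a b)
        (ℚ.+-monoʳ-≤ a (ℚ.*-monoʳ-≤-nonNeg (b ℚ.- a) {{ℚ.nonNegative 0≤b-a}} t≤1))) b<c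
  where
  0≤b-a : 0ℚ ℚ.≤ b ℚ.- a
  0≤b-a = subst (ℚ._≤ b ℚ.- a) (ℚ.+-inverseʳ a) (ℚ.+-monoˡ-≤ (ℚ.- a) a≤b)
... | inj₂ b≤a = ℚ.≤-<-trans (subst (lerpℚ t a b ℚ.≤_)
        (solve 2 (λ a b → a :+ con 0ℚ :* (b :- a) := a) refl a b)
        (ℚ.+-monoʳ-≤ a (ℚ.*-monoʳ-≤-nonPos (b ℚ.- a) {{ℚ.nonPositive b-a≤0}} 0≤t))) a<c
  where
  b-a≤0 : b ℚ.- a ℚ.≤ 0ℚ
  b-a≤0 = subst (b ℚ.- a ℚ.≤_) (ℚ.+-inverseʳ a) (ℚ.+-monoˡ-≤ (ℚ.- a) b≤a)

neg-lerpℚ : ∀ t a b → ℚ.- lerpℚ t a b ≡ lerpℚ t (ℚ.- a) (ℚ.- b)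
neg-lerpℚ = solve 3 (λ t a b → :- (a :+ t :* (b :- a)) := :- a :+ t :* (:- b :- :- a)) refl

∣lerpℚ∣-< : ∀ {t a b e} → 0ℚ ℚ.≤ t → t ℚ.≤ 1ℚ → ∣ a ∣ ℚ.< e → ∣ b ∣ ℚ.< e → ∣ lerpℚ t a b ∣ ℚ.< e
∣lerpℚ∣-< {t} {a} {b} {e} 0≤t t≤1 ∣a∣<e ∣b∣<e = ∣∣<⁺
  (lerpℚ-< 0≤t t≤1 (ℚ.≤-<-trans (p≤∣p∣ a) ∣a∣<e) (ℚ.≤-<-trans (p≤∣p∣ b) ∣b∣<e))
  (subst (ℚ._< e) (sym (neg-lerpℚ t a b))
    (lerpℚ-< 0≤t t≤1 (ℚ.≤-<-trans (-p≤∣p∣ a) ∣a∣<e) (ℚ.≤-<-trans (-p≤∣p∣ b) ∣b∣<e)))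

lerpℚ-> : ∀ {t a b c} → 0ℚ ℚ.≤ t → t ℚ.≤ 1ℚ → c ℚ.< a → c ℚ.< b → c ℚ.< lerpℚ t a b
lerpℚ-> {t} {a} {b} {c} 0≤t t≤1 c<a c<b = linear₁
  (lerpℚ-< {t} 0≤t t≤1 (ℚ.neg-antimono-< c<a) (ℚ.neg-antimono-< c<b))
  (solve 4 (λ t a b c → (a :+ t :* (b :- a)) :- c :=
      :- c :- (:- a :+ t :* (:- b :- :- a))) refl t a b c)

∣p*q∣≤ : ∀ {p q r s} → ∣ p ∣ ℚ.≤ r → ∣ q ∣ ℚ.≤ s → ∣ p ℚ.* q ∣ ℚ.≤ r ℚ.* s
∣p*q∣≤ {p} {q} {r} {s} ∣p∣≤r ∣q∣≤s = begin
  ∣ p ℚ.* q ∣        ≡⟨ ℚ.∣p*q∣≡∣p∣*∣q∣ p q ⟩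
  ∣ p ∣ ℚ.* ∣ q ∣    ≤⟨ ℚ.*-monoʳ-≤-nonNeg ∣ q ∣ {{ℚ.∣-∣-nonNeg q}} ∣p∣≤r ⟩
  r ℚ.* ∣ q ∣        ≤⟨ ℚ.*-monoˡ-≤-nonNeg r {{ℚ.nonNegative (ℚ.≤-trans (ℚ.0≤∣p∣ p) ∣p∣≤r)}} ∣q∣≤s ⟩
  r ℚ.* s            ∎
  where open ℚ.≤-Reasoning

InUnit : Pred ℚ _
InUnit t = 0ℚ ℚ.≤ t × t ℚ.≤ 1ℚ

-- Opaque, because unfolding the modulus of convergence makes type checking explode.
opaque
  lerp-cauchy : (t : ℝ) → (∀ n → seq t n ∈ InUnit) → (a b : ℝ) → ∀ ε → 0ℚ ℚ.< ε →
    ∃[ N ] ∀ m n → N ℕ.≤ m → N ℕ.≤ n →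
    ∣ lerpℚ (seq t m) (seq a m) (seq b m) ℚ.- lerpℚ (seq t n) (seq a n) (seq b n) ∣ ℚ.< ε
  lerp-cauchy t t∈ a b ε 0<ε =
    let 0<½ε              = 0<½* 0<ε
        (A , a-A)         = cauchy a (½ ℚ.* ε) 0<½ε
        (B , b-B)         = cauchy b (½ ℚ.* ε) 0<½ε
        (D , 0≤D , M , d) = bounded (b - a)
        (K , vanish)      = half^-vanishes D (½ ℚ.* ε) 0≤D 0<½ε
        (T , t-T)         = cauchy t (half^ K) (half^-pos K)
    in (A ⊔ B) ⊔ (M ⊔ T) , λ m n N≤m N≤n →
       let AB≤m = ℕ.m⊔n≤o⇒m≤o (A ⊔ B) (M ⊔ T) N≤m
           AB≤n = ℕ.m⊔n≤o⇒m≤o (A ⊔ B) (M ⊔ T) N≤n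
           MT≤m = ℕ.m⊔n≤o⇒n≤o (A ⊔ B) (M ⊔ T) N≤m
           MT≤n = ℕ.m⊔n≤o⇒n≤o (A ⊔ B) (M ⊔ T) N≤n
       in bound m n ε
         (a-A m n (ℕ.m⊔n≤o⇒m≤o A B AB≤m) (ℕ.m⊔n≤o⇒m≤o A B AB≤n))
         (b-B m n (ℕ.m⊔n≤o⇒n≤o A B AB≤m) (ℕ.m⊔n≤o⇒n≤o A B AB≤n))
         (ℚ.≤-<-trans
           (∣p*q∣≤ {seq t m ℚ.- seq t n} {seq b n ℚ.- seq a n}
             (ℚ.<⇒≤ (t-T m n (ℕ.m⊔n≤o⇒n≤o M T MT≤m) (ℕ.m⊔n≤o⇒n≤o M T MT≤n)))
             (d n (ℕ.m⊔n≤o⇒m≤o M T MT≤n)))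
           (vanish K ℕ.≤-refl))
    where
    open ℚ.≤-Reasoning
    -- The first summand is a convex combination of the increments of the two ends; the second
    -- isolates the change of the parameter, whose modulus has to absorb the bound on b - a.
    split : ∀ s t a b a′ b′ → lerpℚ s a b ℚ.- lerpℚ t a′ b′ ≡
            lerpℚ s (a ℚ.- a′) (b ℚ.- b′) ℚ.+ (s ℚ.- t) ℚ.* (b′ ℚ.- a′)
    split = solve 6 (λ s t a b a′ b′ →
      (a :+ s :* (b :- a)) :- (a′ :+ t :* (b′ :- a′)) :=
      ((a :- a′) :+ s :* ((b :- b′) :- (a :- a′))) :+ (s :- t) :* (b′ :- a′)) refl
    bound : ∀ m n ε → ∣ seq a m ℚ.- seq a n ∣ ℚ.< ½ ℚ.* ε → ∣ seq b m ℚ.- seq b n ∣ ℚ.< ½ ℚ.* ε →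
            ∣ (seq t m ℚ.- seq t n) ℚ.* (seq b n ℚ.- seq a n) ∣ ℚ.< ½ ℚ.* ε →
            ∣ lerpℚ (seq t m) (seq a m) (seq b m) ℚ.- lerpℚ (seq t n) (seq a n) (seq b n) ∣ ℚ.< ε
    bound m n ε a< b< t< = begin-strict
      ∣ lerpℚ (seq t m) (seq a m) (seq b m) ℚ.- lerpℚ (seq t n) (seq a n) (seq b n) ∣
        ≡⟨ cong ∣_∣ (split (seq t m) (seq t n) (seq a m) (seq b m) (seq a n) (seq b n)) ⟩
      ∣ l ℚ.+ r ∣        ≤⟨ ℚ.∣p+q∣≤∣p∣+∣q∣ l r ⟩
      ∣ l ∣ ℚ.+ ∣ r ∣    <⟨ ℚ.+-mono-< (∣lerpℚ∣-< {seq t m} (proj₁ (t∈ m)) (proj₂ (t∈ m)) a< b<) t< ⟩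
      ½ ℚ.* ε ℚ.+ ½ ℚ.* ε ≡⟨ ½+½ ε ⟩
      ε                  ∎
      where
      l r : ℚ
      l = lerpℚ (seq t m) (seq a m ℚ.- seq a n) (seq b m ℚ.- seq b n)
      r = (seq t m ℚ.- seq t n) ℚ.* (seq b n ℚ.- seq a n)

lerp : (t : ℝ) → (∀ n → seq t n ∈ InUnit) → ℝ → ℝ → ℝ
lerp t t∈ a b = mkℝ (λ n → lerpℚ (seq t n) (seq a n) (seq b n)) (lerp-cauchy t t∈ a b)

private
  lerp-minus : ∀ t a b a′ b′ → lerpℚ t a b ℚ.- lerpℚ t a′ b′ ≡ lerpℚ t (a ℚ.- a′) (b ℚ.- b′)
  lerp-minus = solve 5 (λ t a b a′ b′ →
    (a :+ t :* (b :- a)) :- (a′ :+ t :* (b′ :- a′)) :=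
    (a :- a′) :+ t :* ((b :- b′) :- (a :- a′))) refl

-- Interpolation commutes with differences of coordinates and with adding a constant to both ends,
-- so the smaller of the two margins survives.
lerp-minus-< : ∀ t t∈ {a b a′ b′ c} → a - a′ <ℝ c → b - b′ <ℝ c →
               lerp t t∈ a b - lerp t t∈ a′ b′ <ℝ c
lerp-minus-< t t∈ {a} {b} {a′} {b′} {c} (ε , 0<ε , M , a<) (δ , 0<δ , N , b<) =
  ε ℚ.⊓ δ , ⊓-pos 0<ε 0<δ , M ⊔ N , λ n le →
    subst (ℚ._< seq c n)
      (trans (plus (seq t n) (seq a n ℚ.- seq a′ n) (seq b n ℚ.- seq b′ n) (ε ℚ.⊓ δ))
        (cong (ℚ._+ (ε ℚ.⊓ δ)) (sym (lerp-minus (seq t n) (seq a n) (seq b n) (seq a′ n) (seq b′ n)))))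
      (lerpℚ-< {seq t n} (proj₁ (t∈ n)) (proj₂ (t∈ n))
        (ℚ.≤-<-trans (ℚ.+-monoʳ-≤ (seq a n ℚ.- seq a′ n) (ℚ.p⊓q≤p ε δ)) (a< n (ℕ.m⊔n≤o⇒m≤o M N le)))
        (ℚ.≤-<-trans (ℚ.+-monoʳ-≤ (seq b n ℚ.- seq b′ n) (ℚ.p⊓q≤q ε δ)) (b< n (ℕ.m⊔n≤o⇒n≤o M N le))))
  where
  plus : ∀ t a b e → lerpℚ t (a ℚ.+ e) (b ℚ.+ e) ≡ lerpℚ t a b ℚ.+ e
  plus = solve 4 (λ t a b e → (a :+ e) :+ t :* ((b :+ e) :- (a :+ e)) :=
    (a :+ t :* (b :- a)) :+ e) refl

lerp-minus-> : ∀ t t∈ {a b a′ b′ c} → c <ℝ a - a′ → c <ℝ b - b′ →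
               c <ℝ lerp t t∈ a b - lerp t t∈ a′ b′
lerp-minus-> t t∈ {a} {b} {a′} {b′} {c} (ε , 0<ε , M , a<) (δ , 0<δ , N , b<) =
  ε ℚ.⊓ δ , ⊓-pos 0<ε 0<δ , M ⊔ N , λ n le →
    subst (seq c n ℚ.+ (ε ℚ.⊓ δ) ℚ.<_)
      (sym (lerp-minus (seq t n) (seq a n) (seq b n) (seq a′ n) (seq b′ n)))
      (lerpℚ-> {seq t n} (proj₁ (t∈ n)) (proj₂ (t∈ n))
        (ℚ.≤-<-trans (ℚ.+-monoʳ-≤ (seq c n) (ℚ.p⊓q≤p ε δ)) (a< n (ℕ.m⊔n≤o⇒m≤o M N le)))
        (ℚ.≤-<-trans (ℚ.+-monoʳ-≤ (seq c n) (ℚ.p⊓q≤q ε δ)) (b< n (ℕ.m⊔n≤o⇒n≤o M N le))))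

-- Connected components of the complement of an arrangement

below-open : ∀ {n} (i j : Fin n) c → Open (λ x → x i - x j <ℝ c)
below-open i j c x (ε , 0<ε , N , lt) =
  fromℚ h , fromℚ-mono (0<½* 0<ε) , λ {y} ball →
  let (η , 0<η , M , i<) = proj₂ (ball i)
      (θ , 0<θ , L , j<) = proj₁ (ball j)
  in η ℚ.+ θ , ℚ.+-mono-< 0<η 0<θ , N ⊔ (M ⊔ L) , λ n le →
     linear₃ (subst (λ e → seq (x i) n ℚ.- seq (x j) n ℚ.+ e ℚ.< seq c n) (sym (½+½ ε))
               (lt n (ℕ.m⊔n≤o⇒m≤o N (M ⊔ L) le)))
             (i< n (ℕ.m⊔n≤o⇒m≤o M L (ℕ.m⊔n≤o⇒n≤o N (M ⊔ L) le)))
             (j< n (ℕ.m⊔n≤o⇒n≤o M L (ℕ.m⊔n≤o⇒n≤o N (M ⊔ L) le)))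
             (identity (seq c n) (seq (x i) n) (seq (x j) n) (seq (y i) n) (seq (y j) n) η θ h)
  where
  -- Both coordinates move, each by less than h, which may use up all of ε; the margin of the new
  -- inequality is the sum of the margins η and θ supplied by the ball.
  h = ½ ℚ.* ε
  identity : ∀ c xᵢ xⱼ yᵢ yⱼ η θ h → c ℚ.- (yᵢ ℚ.- yⱼ ℚ.+ (η ℚ.+ θ)) ≡
    c ℚ.- (xᵢ ℚ.- xⱼ ℚ.+ (h ℚ.+ h)) ℚ.+ (h ℚ.- (yᵢ ℚ.- xᵢ ℚ.+ η)) ℚ.+ (h ℚ.- (xⱼ ℚ.- yⱼ ℚ.+ θ))
  identity = solve 8 (λ c xᵢ xⱼ yᵢ yⱼ η θ h → c :- (yᵢ :- yⱼ :+ (η :+ θ)) :=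
    c :- (xᵢ :- xⱼ :+ (h :+ h)) :+ (h :- (yᵢ :- xᵢ :+ η)) :+ (h :- (xⱼ :- yⱼ :+ θ))) refl

above-open : ∀ {n} (i j : Fin n) c → Open (λ x → c <ℝ x i - x j)
above-open i j c x (ε , 0<ε , N , lt) =
  fromℚ h , fromℚ-mono (0<½* 0<ε) , λ {y} ball →
  let (η , 0<η , M , i<) = proj₁ (ball i)
      (θ , 0<θ , L , j<) = proj₂ (ball j)
  in η ℚ.+ θ , ℚ.+-mono-< 0<η 0<θ , N ⊔ (M ⊔ L) , λ n le →
     linear₃ (subst (λ e → seq c n ℚ.+ e ℚ.< seq (x i) n ℚ.- seq (x j) n) (sym (½+½ ε))
               (lt n (ℕ.m⊔n≤o⇒m≤o N (M ⊔ L) le)))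
             (i< n (ℕ.m⊔n≤o⇒m≤o M L (ℕ.m⊔n≤o⇒n≤o N (M ⊔ L) le)))
             (j< n (ℕ.m⊔n≤o⇒n≤o M L (ℕ.m⊔n≤o⇒n≤o N (M ⊔ L) le)))
             (identity (seq c n) (seq (x i) n) (seq (x j) n) (seq (y i) n) (seq (y j) n) η θ h)
  where
  h = ½ ℚ.* ε
  identity : ∀ c xᵢ xⱼ yᵢ yⱼ η θ h → yᵢ ℚ.- yⱼ ℚ.- (c ℚ.+ (η ℚ.+ θ)) ≡
    xᵢ ℚ.- xⱼ ℚ.- (c ℚ.+ (h ℚ.+ h)) ℚ.+ (h ℚ.- (xᵢ ℚ.- yᵢ ℚ.+ η)) ℚ.+ (h ℚ.- (yⱼ ℚ.- xⱼ ℚ.+ θ))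
  identity = solve 8 (λ c xᵢ xⱼ yᵢ yⱼ η θ h → yᵢ :- yⱼ :- (c :+ (η :+ θ)) :=
    xᵢ :- xⱼ :- (c :+ (h :+ h)) :+ (h :- (xᵢ :- yᵢ :+ η)) :+ (h :- (yⱼ :- xⱼ :+ θ))) refl

-- Implications from x to y suffice: a point x of the complement satisfies one premise for each
-- hyperplane, which puts y in the complement and on the same side. In this form the set is convex
-- for every x.
SameSide : ∀ {n} → Arrangement n → ℝ^ n → Pred (ℝ^ n) _
SameSide 𝒜 x y = ∀ {i j c} → hyperplane i j c ∈ 𝒜 →
  (x i - x j <ℝ c → y i - y j <ℝ c) × (c <ℝ x i - x j → c <ℝ y i - y j)

component⇒sameSide : ∀ {n} {𝒜 : Arrangement n} {x y} →
                     InComponent (Complement 𝒜) x y → SameSide 𝒜 x y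
component⇒sameSide {𝒜 = 𝒜} {x} {y} (C , C⊆ , conn , x∈C , y∈C) {i} {j} {c} h = below , above
  where
  U V : Pred _ _
  U z = z i - z j <ℝ c
  V z = c <ℝ z i - z j
  separated : Satisfiable (C ∩ U) → Satisfiable (C ∩ V) → ⊥
  separated p q = conn U V (below-open i j c) (above-open i j c) (λ z∈C → C⊆ z∈C h) p q
    λ z (_ , z∈U , z∈V) → <ℝ-asym {z i - z j} {c} z∈U z∈V
  below : x ∈ U → y ∈ U
  below x∈U with C⊆ y∈C h
  ... | inj₁ y∈U = y∈U
  ... | inj₂ y∈V = contradiction (y , y∈C , y∈V) (separated (x , x∈C , x∈U))
  above : x ∈ V → y ∈ V
  above x∈V with C⊆ y∈C h
  ... | inj₁ y∈U = contradiction (x , x∈C , x∈V) (separated (y , y∈C , y∈U))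
  ... | inj₂ y∈V = y∈V

lerp^ : ∀ {n} (t : ℝ) → (∀ k → seq t k ∈ InUnit) → ℝ^ n → ℝ^ n → ℝ^ n
lerp^ t t∈ a b i = lerp t t∈ (a i) (b i)

Convex : ∀ {n} → Pred (ℝ^ n) _ → Set
Convex C = ∀ t t∈ {a b} → a ∈ C → b ∈ C → lerp^ t t∈ a b ∈ C

eventually : ∀ {n} {P : Fin n → ℕ → Set} →
             (∀ i → ∃[ N ] ∀ k → N ℕ.≤ k → P i k) → ∃[ N ] ∀ i k → N ℕ.≤ k → P i k
eventually {zero}  f = 0 , λ ()
eventually {suc n} f =
  let (M , p) = f zero
      (N , q) = eventually (λ i → f (suc i))
  in M ⊔ N , λ { zero k le → p k (ℕ.m⊔n≤o⇒m≤o M N le) ; (suc i) k le → q i k (ℕ.m⊔n≤o⇒n≤o M N le) }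

-- The limit of the bisection lies in U or V, so by openness some bracket has both
-- ends in that set, and one of its ends lies in C ∩ U ∩ V.
module Bisection {n} {C U V : Pred (ℝ^ n) _} (convex : Convex C)
  (U-open : Open U) (V-open : Open V) (cover : C ⊆ U ∪ V)
  {a b : ℝ^ n} (a∈C : a ∈ C) (b∈C : b ∈ C) (a∈U : a ∈ U) (b∈V : b ∈ V)
  (empty : Empty (C ∩ (U ∩ V))) where

  at : ∀ q → q ∈ InUnit → ℝ^ n
  at q q∈ = lerp^ (fromℚ q) (λ _ → q∈) a b

  -- The upper end is computed from the lower one, so the k-th bracket has width `half^ k` by
  -- definition and the convergence of the lower ends needs no separate estimate of lengths.
  record Bracket (k : ℕ) : Set where
    field
      lo    : ℚ
      0≤lo  : 0ℚ ℚ.≤ lo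
      hi≤1  : lo ℚ.+ half^ k ℚ.≤ 1ℚ

    hi : ℚ
    hi = lo ℚ.+ half^ k

    lo≤hi : lo ℚ.≤ hi
    lo≤hi = subst (ℚ._≤ hi) (ℚ.+-identityʳ lo) (ℚ.+-monoʳ-≤ lo (ℚ.<⇒≤ (half^-pos k)))

    lo∈ : lo ∈ InUnit
    lo∈ = 0≤lo , ℚ.≤-trans lo≤hi hi≤1

    hi∈ : hi ∈ InUnit
    hi∈ = ℚ.≤-trans 0≤lo lo≤hi , hi≤1

    field
      lo∈U : at lo lo∈ ∈ U
      hi∈V : at hi hi∈ ∈ V

  open Bracket

  -- Termwise equal points lie in every ball around each other. Propositional equality in `ℝ^ n`
  -- would ask for equal functions and equal `cauchy` fields, so points that are computed
  -- differently are exchanged through openness instead.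
  Open-resp : ∀ (W : Pred (ℝ^ n) _) x y → Open W → (∀ i k → seq (x i) k ≡ seq (y i) k) → x ∈ W → y ∈ W
  Open-resp W x y W-open eq x∈W with W-open x x∈W
  ... | ε , (η , 0<η , N , 0<ε) , ball⊆ = ball⊆ λ i →
    (η , 0<η , N , λ k le → subst (λ d → d ℚ.+ η ℚ.< seq ε k) (sym (zeroˡ i k)) (0<ε k le)) ,
    (η , 0<η , N , λ k le → subst (λ d → d ℚ.+ η ℚ.< seq ε k) (sym (zeroʳ i k)) (0<ε k le))
    where
    zeroˡ : ∀ i k → seq (x i) k ℚ.- seq (y i) k ≡ 0ℚ
    zeroˡ i k = trans (cong (ℚ._- seq (y i) k) (eq i k)) (ℚ.+-inverseʳ (seq (y i) k))
    zeroʳ : ∀ i k → seq (y i) k ℚ.- seq (x i) k ≡ 0ℚ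
    zeroʳ i k = trans (cong (λ z → seq (y i) k ℚ.- z) (eq i k)) (ℚ.+-inverseʳ (seq (y i) k))

  initial : Bracket 0
  initial = record
    { lo   = 0ℚ
    ; 0≤lo = ℚ.≤-refl
    ; hi≤1 = ℚ.≤-reflexive (ℚ.+-identityˡ 1ℚ)
    ; lo∈U = Open-resp U a _ U-open (λ i k → solve 2 (λ a b → a := a :+ con 0ℚ :* (b :- a)) refl (seq (a i) k) (seq (b i) k)) a∈U
    ; hi∈V = Open-resp V b _ V-open (λ i k → solve 2 (λ a b → b := a :+ (con 0ℚ :+ con 1ℚ) :* (b :- a)) refl (seq (a i) k) (seq (b i) k)) b∈V
    }

  at-resp : ∀ {W p q} → Open W → p ≡ q → ∀ p∈ q∈ → at p p∈ ∈ W → at q q∈ ∈ W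
  at-resp {W} {p} W-open refl p∈ q∈ = Open-resp W (at p p∈) (at p q∈) W-open (λ _ _ → refl)

  module _ {k} (s : Bracket k) where

    mid : ℚ
    mid = lo s ℚ.+ half^ (suc k)

    mid+half : mid ℚ.+ half^ (suc k) ≡ hi s
    mid+half = trans (ℚ.+-assoc (lo s) (half^ (suc k)) (half^ (suc k))) (cong (lo s ℚ.+_) (half^-split k))

    mid≤hi : mid ℚ.≤ hi s
    mid≤hi = ℚ.+-monoʳ-≤ (lo s) (half^-suc-≤ k)

    lo≤mid : lo s ℚ.≤ mid
    lo≤mid = subst (ℚ._≤ mid) (ℚ.+-identityʳ (lo s)) (ℚ.+-monoʳ-≤ (lo s) (ℚ.<⇒≤ (half^-pos (suc k))))

    mid∈ : mid ∈ InUnit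
    mid∈ = ℚ.≤-trans (0≤lo s) lo≤mid , ℚ.≤-trans mid≤hi (hi≤1 s)

    Inside : Pred (Bracket (suc k)) _
    Inside t = lo s ℚ.≤ lo t × hi t ℚ.≤ hi s

    refine : at mid mid∈ ∈ U ∪ V → ∃[ t ] Inside t
    refine (inj₁ mid∈U) = record
      { lo   = mid
      ; 0≤lo = proj₁ mid∈
      ; hi≤1 = subst (ℚ._≤ 1ℚ) (sym mid+half) (hi≤1 s)
      ; lo∈U = at-resp {U} U-open refl mid∈ _ mid∈U
      ; hi∈V = at-resp {V} V-open (sym mid+half) (hi∈ s) _ (hi∈V s)
      } , lo≤mid , ℚ.≤-reflexive mid+half
    refine (inj₂ mid∈V) = record
      { lo   = lo s
      ; 0≤lo = 0≤lo s
      ; hi≤1 = proj₂ mid∈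
      ; lo∈U = at-resp {U} U-open refl (lo∈ s) _ (lo∈U s)
      ; hi∈V = at-resp {V} V-open refl mid∈ _ mid∈V
      } , ℚ.≤-refl , mid≤hi

    step : ∃[ t ] Inside t
    step = refine (cover (convex _ _ a∈C b∈C))

  bracket : ∀ k → Bracket k
  bracket zero    = initial
  bracket (suc k) = proj₁ (step (bracket k))

  nested : ∀ {k l} → k ℕ.≤′ l →
           lo (bracket k) ℚ.≤ lo (bracket l) × hi (bracket l) ℚ.≤ hi (bracket k)
  nested ℕ.≤′-refl = ℚ.≤-refl , ℚ.≤-refl
  nested (ℕ.≤′-step {l} le) =
    let (lo≤ , hi≤)   = nested le
        (lo≤′ , hi≤′) = proj₂ (step (bracket l))
    in ℚ.≤-trans lo≤ lo≤′ , ℚ.≤-trans hi≤′ hi≤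

  Within : ℕ → Pred ℚ _
  Within k q = lo (bracket k) ℚ.≤ q × q ℚ.≤ hi (bracket k)

  within : ∀ {k l} → k ℕ.≤ l → lo (bracket l) ∈ Within k
  within {k} {l} le = let (p , q) = nested (ℕ.≤⇒≤′ le) in
    p , ℚ.≤-trans (lo≤hi (bracket l)) q

  within-close : ∀ k {p q} → p ∈ Within k → q ∈ Within k → ∣ p ℚ.- q ∣ ℚ.≤ half^ k
  within-close k {p} {q} (l≤p , p≤h) (l≤q , q≤h) = ∣∣≤⁺
    (p-q≤r (ℚ.≤-trans p≤h (ℚ.+-monoˡ-≤ (half^ k) l≤q)))
    (subst (ℚ._≤ half^ k) (solve 2 (λ p q → q :- p := :- (p :- q)) refl p q)
      (p-q≤r (ℚ.≤-trans q≤h (ℚ.+-monoˡ-≤ (half^ k) l≤p))))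

  opaque
    limit-cauchy : ∀ ε → 0ℚ ℚ.< ε → ∃[ N ] ∀ m n → N ℕ.≤ m → N ℕ.≤ n →
                   ∣ lo (bracket m) ℚ.- lo (bracket n) ∣ ℚ.< ε
    limit-cauchy ε 0<ε =
      let (K , vanish) = half^-vanishes 1ℚ ε (ℚ.<⇒≤ 0<1) 0<ε in
      K , λ m n K≤m K≤n → ℚ.≤-<-trans (within-close K (within K≤m) (within K≤n))
        (subst (ℚ._< ε) (ℚ.*-identityʳ (half^ K)) (vanish K ℕ.≤-refl))

  limit : ℝ
  limit = mkℝ (λ k → lo (bracket k)) limit-cauchy

  limit∈ : ∀ k → seq limit k ∈ InUnit
  limit∈ k = lo∈ (bracket k)

  limitPoint : ℝ^ n
  limitPoint = lerp^ limit limit∈ a b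

  -- In coordinate i a point of bracket K differs from the limit by at most `half^ K` times a bound
  -- on b i - a i. One K must serve all coordinates, hence `uniform`. Half of η pays for this
  -- distance, the other half is the margin required by `_<ℝ_`.
  close : ∀ {ε} → 0ℝ <ℝ ε →
          ∃[ k ] ∀ q (q∈ : q ∈ InUnit) → q ∈ Within k → Ball limitPoint ε (at q q∈)
  close {ε} (η , 0<η , N , η<ε) = K , λ q q∈ q-in i →
    let (B , _ , M , d) = bounded (b i - a i)
        gap< : ∀ m → (K ⊔ N) ⊔ M ℕ.≤ m →
               ∣ (lo (bracket m) ℚ.- q) ℚ.* (seq (b i) m ℚ.- seq (a i) m) ∣ ℚ.< ½ ℚ.* η
        gap< m le = ℚ.≤-<-trans
          (∣p*q∣≤ {lo (bracket m) ℚ.- q} {seq (b i) m ℚ.- seq (a i) m}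
            (within-close K (within (ℕ.m⊔n≤o⇒m≤o K N (ℕ.m⊔n≤o⇒m≤o (K ⊔ N) M le))) q-in)
            (d m (ℕ.m⊔n≤o⇒n≤o (K ⊔ N) M le)))
          (small i K ℕ.≤-refl)
        η<ε′ : ∀ m → (K ⊔ N) ⊔ M ℕ.≤ m → ½ ℚ.* η ℚ.+ ½ ℚ.* η ℚ.< seq ε m
        η<ε′ m le = subst (ℚ._< seq ε m) (trans (ℚ.+-identityˡ η) (sym (½+½ η)))
          (η<ε m (ℕ.m⊔n≤o⇒n≤o K N (ℕ.m⊔n≤o⇒m≤o (K ⊔ N) M le)))
    in (½ ℚ.* η , 0<½* 0<η , (K ⊔ N) ⊔ M , λ m le → ℚ.<-trans
         (ℚ.+-monoˡ-< (½ ℚ.* η) (subst (ℚ._< ½ ℚ.* η)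
           (sym (diff (lo (bracket m)) q (seq (a i) m) (seq (b i) m)))
           (ℚ.≤-<-trans (p≤∣p∣ _) (gap< m le)))) (η<ε′ m le)) ,
       (½ ℚ.* η , 0<½* 0<η , (K ⊔ N) ⊔ M , λ m le → ℚ.<-trans
         (ℚ.+-monoˡ-< (½ ℚ.* η) (subst (ℚ._< ½ ℚ.* η)
           (sym (diff′ (lo (bracket m)) q (seq (a i) m) (seq (b i) m)))
           (ℚ.≤-<-trans (-p≤∣p∣ _) (gap< m le)))) (η<ε′ m le))
    where
    uniform : ∃[ K ] ∀ i k → K ℕ.≤ k → half^ k ℚ.* proj₁ (bounded (b i - a i)) ℚ.< ½ ℚ.* η
    uniform = eventually λ i → let (B , 0≤B , _) = bounded (b i - a i) in
      half^-vanishes B (½ ℚ.* η) 0≤B (0<½* 0<η)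
    K = proj₁ uniform
    small = proj₂ uniform
    diff : ∀ t q a b → lerpℚ t a b ℚ.- lerpℚ q a b ≡ (t ℚ.- q) ℚ.* (b ℚ.- a)
    diff = solve 4 (λ t q a b → (a :+ t :* (b :- a)) :- (a :+ q :* (b :- a)) := (t :- q) :* (b :- a)) refl
    diff′ : ∀ t q a b → lerpℚ q a b ℚ.- lerpℚ t a b ≡ ℚ.- ((t ℚ.- q) ℚ.* (b ℚ.- a))
    diff′ = solve 4 (λ t q a b → (a :+ q :* (b :- a)) :- (a :+ t :* (b :- a)) := :- ((t :- q) :* (b :- a))) refl

  absurd : ⊥
  absurd with cover (convex limit limit∈ a∈C b∈C)
  ... | inj₁ z∈U =
    let (ε , 0<ε , ball⊆U) = U-open _ z∈U
        (k , near)         = close {ε} 0<ε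
        s                  = bracket k
    in empty _ (convex _ _ a∈C b∈C , ball⊆U (near (hi s) (hi∈ s) (lo≤hi s , ℚ.≤-refl)) , hi∈V s)
  ... | inj₂ z∈V =
    let (ε , 0<ε , ball⊆V) = V-open _ z∈V
        (k , near)         = close {ε} 0<ε
        s                  = bracket k
    in empty _ (convex _ _ a∈C b∈C , lo∈U s , ball⊆V (near (lo s) (lo∈ s) (ℚ.≤-refl , lo≤hi s)))

convex⇒connected : ∀ {n} {C : Pred (ℝ^ n) _} → Convex C → Connected C
convex⇒connected convex U V U-open V-open cover (a , a∈C , a∈U) (b , b∈C , b∈V) empty =
  Bisection.absurd convex U-open V-open cover a∈C b∈C a∈U b∈V empty

sameSide⇒component : ∀ {n} {𝒜 : Arrangement n} {x y} → x ∈ Complement 𝒜 →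
                     SameSide 𝒜 x y → InComponent (Complement 𝒜) x y
sameSide⇒component {𝒜 = 𝒜} {x} {y} x∈ same =
  SameSide 𝒜 x , (λ {z} → complement {z}) , convex⇒connected convex , (λ _ → (λ p → p) , λ p → p) , same
  where
  complement : SameSide 𝒜 x ⊆ Complement 𝒜
  complement s h with x∈ h
  ... | inj₁ lt = inj₁ (proj₁ (s h) lt)
  ... | inj₂ gt = inj₂ (proj₂ (s h) gt)
  convex : Convex (SameSide 𝒜 x)
  convex t t∈ {a} {b} a∈ b∈ {i} {j} {c} h =
    (λ lt → lerp-minus-< t t∈ {a i} {b i} {a j} {b j} {c} (proj₁ (a∈ h) lt) (proj₁ (b∈ h) lt)) ,
    (λ gt → lerp-minus-> t t∈ {a i} {b i} {a j} {b j} {c} (proj₂ (a∈ h) gt) (proj₂ (b∈ h) gt))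

-- Permutations and rankings

injective⇒surjective : ∀ {n} {f : Fin n → Fin n} → Injective _≡_ _≡_ f → ∀ y → ∃[ x ] f x ≡ y
injective⇒surjective {suc n} {f} inj y with Fin.any? (λ x → f x Fin.≟ y)
... | yes hit = hit
... | no miss = contradiction (Fin.injective⇒≤ {f = avoid} avoid-injective) ℕ.1+n≰n
  where
  y≢f : ∀ x → y ≢ f x
  y≢f x eq = miss (x , sym eq)
  avoid : Fin (suc n) → Fin n
  avoid x = punchOut (y≢f x)
  avoid-injective : Injective _≡_ _≡_ avoid
  avoid-injective {a} {b} eq = inj (Fin.punchOut-injective (y≢f a) (y≢f b) eq)

injective⇒permutation : ∀ {n} (f : Fin n → Fin n) → Injective _≡_ _≡_ f → Permutation′ n
injective⇒permutation f inj = permutation f (proj₁ ∘ surj) (proj₂ ∘ surj) (λ x → inj (proj₂ (surj (f x))))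
  where surj = injective⇒surjective inj

position-injective : ∀ {n} (w : Permutation′ n) {i j} → w ⟨$⟩ˡ i ≡ w ⟨$⟩ˡ j → i ≡ j
position-injective w eq = trans (sym (inverseʳ w)) (trans (cong (w ⟨$⟩ʳ_) eq) (inverseʳ w))

position-connex : ∀ {n} (w : Permutation′ n) {i j} → i ≢ j → w ⟨$⟩ˡ i < w ⟨$⟩ˡ j ⊎ w ⟨$⟩ˡ j < w ⟨$⟩ˡ i
position-connex w {i} {j} i≢j with Fin.<-cmp (w ⟨$⟩ˡ i) (w ⟨$⟩ˡ j)
... | tri< lt _ _ = inj₁ lt
... | tri≈ _ eq _ = contradiction (position-injective w eq) i≢j
... | tri> _ _ gt = inj₂ gt

module _ {n ℓ} {_≺_ : Rel (Fin n) ℓ} (≺-trans : B.Transitive _≺_) (≺-irrefl : ∀ {i} → ¬ (i ≺ i))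
  (≺-connex : ∀ {i j} → i ≢ j → i ≺ j ⊎ j ≺ i) where

  private
    -- Comparability of distinct elements decides the relation. This is how real coordinates can be
    -- sorted.
    _≺?_ : B.Decidable _≺_
    i ≺? j with i Fin.≟ j
    ... | yes refl = no ≺-irrefl
    ... | no i≢j with ≺-connex i≢j
    ...   | inj₁ i≺j = yes i≺j
    ...   | inj₂ j≺i = no λ i≺j → ≺-irrefl (≺-trans i≺j j≺i)

    before : Fin n → Subset n
    before j = Vec.tabulate (λ i → does (i ≺? j))

    ∈-before⁺ : ∀ {i j} → i ≺ j → i Subset.∈ before j
    ∈-before⁺ {i} {j} i≺j = Vec.lookup⇒[]= i (before j)
      (trans (Vec.lookup∘tabulate (λ i → does (i ≺? j)) i) (dec-true (i ≺? j) i≺j))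

    ∈-before⁻ : ∀ {i j} → i Subset.∈ before j → i ≺ j
    ∈-before⁻ {i} {j} i∈
      with i ≺? j | trans (sym (Vec.lookup∘tabulate (λ i → does (i ≺? j)) i)) (Vec.[]=⇒lookup i∈)
    ... | yes i≺j | _ = i≺j

    before-⊂ : ∀ {i j} → i ≺ j → before i ⊂ before j
    before-⊂ {i} i≺j = (λ k∈ → ∈-before⁺ (≺-trans (∈-before⁻ k∈) i≺j)) ,
      i , ∈-before⁺ i≺j , λ i∈ → ≺-irrefl (∈-before⁻ i∈)

    rank-< : ∀ j → Subset.∣ before j ∣ ℕ.< n
    rank-< j = subst (Subset.∣ before j ∣ ℕ.<_) (Subset.∣⊤∣≡n n)
      (Subset.p⊂q⇒∣p∣<∣q∣ (Subset.⊆-max (before j) , j , Subset.∈⊤ , λ j∈ → ≺-irrefl (∈-before⁻ j∈)))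

    rank : Fin n → Fin n
    rank j = fromℕ< (rank-< j)

    rank-mono : ∀ {i j} → i ≺ j → rank i < rank j
    rank-mono {i} {j} i≺j = subst₂ ℕ._<_ (sym (Fin.toℕ-fromℕ< (rank-< i))) (sym (Fin.toℕ-fromℕ< (rank-< j)))
      (Subset.p⊂q⇒∣p∣<∣q∣ (before-⊂ i≺j))

    rank-injective : Injective _≡_ _≡_ rank
    rank-injective {i} {j} eq with i Fin.≟ j
    ... | yes i≡j = i≡j
    ... | no i≢j with ≺-connex i≢j
    ...   | inj₁ i≺j = contradiction (rank-mono i≺j) (Fin.<-irrefl eq)
    ...   | inj₂ j≺i = contradiction (rank-mono j≺i) (Fin.<-irrefl (sym eq))

  opaque
    sorting : Σ[ w ∈ Permutation′ n ] (∀ {i j} → i ≺ j → w ⟨$⟩ˡ i < w ⟨$⟩ˡ j)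
    -- `rank` sends an element to its position, which is the direction `⟨$⟩ˡ` of the word.
    sorting = flip (injective⇒permutation rank rank-injective) , rank-mono

-- If g i < i, then g (g i) < g i, so g i is a smaller counterexample.
monotone⇒inflationary : ∀ {n} (g : Fin n → Fin n) → (∀ {i j} → i < j → g i < g j) → ∀ i → i Fin.≤ g i
monotone⇒inflationary g mono i = go (Fin.<-wellFounded i)
  where
  go : ∀ {i} → Acc _<_ i → i Fin.≤ g i
  go {i} (acc rs) with toℕ i ℕ.≤? toℕ (g i)
  ... | yes le = le
  ... | no nle = contradiction (go (rs (ℕ.≰⇒> nle))) (ℕ.<⇒≱ (mono (ℕ.≰⇒> nle)))

-- The map from positions in one word to positions in the other is increasing, hence inflationary,
-- and so is its inverse.
positions-unique : ∀ {n} (w v : Permutation′ n) →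
  (∀ {i j} → w ⟨$⟩ˡ i < w ⟨$⟩ˡ j → v ⟨$⟩ˡ i < v ⟨$⟩ˡ j) →
  (∀ {i j} → v ⟨$⟩ˡ i < v ⟨$⟩ˡ j → w ⟨$⟩ˡ i < w ⟨$⟩ˡ j) →
  ∀ i → w ⟨$⟩ˡ i ≡ v ⟨$⟩ˡ i
positions-unique w v w⇒v v⇒w i = Fin.≤-antisym (le w v w⇒v i) (le v w v⇒w i)
  where
  le : ∀ w v → (∀ {i j} → w ⟨$⟩ˡ i < w ⟨$⟩ˡ j → v ⟨$⟩ˡ i < v ⟨$⟩ˡ j) → ∀ i → w ⟨$⟩ˡ i Fin.≤ v ⟨$⟩ˡ i
  le w v w⇒v i = subst (λ k → w ⟨$⟩ˡ i Fin.≤ v ⟨$⟩ˡ k) (inverseʳ w)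
    (monotone⇒inflationary (λ p → v ⟨$⟩ˡ (w ⟨$⟩ʳ p))
      (λ p<q → w⇒v (subst₂ _<_ (sym (inverseˡ w)) (sym (inverseˡ w)) p<q)) (w ⟨$⟩ˡ i))

-- Counting

unique⇒lookup-injective : ∀ {A : Set} {xs : List A} → Unique xs → Injective _≡_ _≡_ (List.lookup xs)
unique⇒lookup-injective {xs = _ ∷ _} _          {zero}  {zero}  _  = refl
unique⇒lookup-injective {xs = _ ∷ _} (x∉ ∷ _)   {zero}  {suc j} eq = contradiction eq (All.lookup x∉ (∈-lookup j))
unique⇒lookup-injective {xs = _ ∷ _} (x∉ ∷ _)   {suc i} {zero}  eq = contradiction (sym eq) (All.lookup x∉ (∈-lookup i))
unique⇒lookup-injective {xs = _ ∷ _} (_ ∷ uniq) {suc i} {suc j} eq = cong suc (unique⇒lookup-injective uniq eq)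

module _ {n} {P : Pred (Fin n) 0ℓ} (P? : Decidable P) where

  count≥ : ∀ {m} (g : Fin m → Fin n) → Injective _≡_ _≡_ g → (∀ r → P (g r)) →
           m ℕ.≤ length (filter P? (allFin n))
  count≥ g g-inj Pg = Fin.injective⇒≤ {f = λ r → index (member r)} λ {r} {s} eq →
    g-inj (trans (Any.lookup-index (member r))
      (trans (cong (List.lookup (filter P? (allFin n))) eq) (sym (Any.lookup-index (member s)))))
    where
    member : ∀ r → g r ∈ˡ filter P? (allFin n)
    member r = ∈-filter⁺ P? (∈-allFin (g r)) (Pg r)

  count≤ : ∀ {m} (g : ∀ i → P i → Fin m) →
           (∀ {i j} p q → g i p ≡ g j q → i ≡ j) → length (filter P? (allFin n)) ℕ.≤ m
  count≤ g g-inj = Fin.injective⇒≤ {f = λ k → g (List.lookup xs k) (holds k)} λ {k} {l} eq →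
    unique⇒lookup-injective (Unique.filter⁺ P? (Unique.allFin⁺ n)) (g-inj (holds k) (holds l) eq)
    where
    xs = filter P? (allFin n)
    holds : ∀ k → P (List.lookup xs k)
    holds k = proj₂ (∈-filter⁻ P? {xs = allFin n} (∈-lookup k))

-- Fibres of f, listed increasingly

module _ {n : ℕ} (f : Fin n → Fin n) where

  nextEqual? : ∀ i j → Dec (NextEqual f i j)
  nextEqual? i j = i Fin.<? j ×-dec f i Fin.≟ f j ×-dec
    Fin.all? (λ k → i Fin.<? k →-dec (f i Fin.≟ f k →-dec j Fin.≤? k))

  -- The least elements of the fibres, phrased by `NextEqual` so as to match the elements without an
  -- incoming remaining arc.
  First : Fin n → Set
  First i = ∀ j → ¬ NextEqual f j i

  NextEqual-functional : ∀ {i j k} → NextEqual f i j → NextEqual f i k → j ≡ k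
  NextEqual-functional (i<j , fi≡fj , j-min) (i<k , fi≡fk , k-min) =
    Fin.≤-antisym (j-min _ i<k fi≡fk) (k-min _ i<j fi≡fj)

  NextEqual-injective : ∀ {i j k} → NextEqual f i k → NextEqual f j k → i ≡ j
  NextEqual-injective {i} {j} (i<k , fi≡fk , i-min) (j<k , fj≡fk , j-min) with Fin.<-cmp i j
  ... | tri< i<j _ _ = contradiction j<k (ℕ.≤⇒≯ (i-min j i<j (trans fi≡fk (sym fj≡fk))))
  ... | tri≈ _ i≡j _ = i≡j
  ... | tri> _ _ j<i = contradiction i<k (ℕ.≤⇒≯ (j-min i j<i (trans fj≡fk (sym fi≡fk))))

  predecessor? : ∀ i → (∃[ j ] NextEqual f j i) ⊎ First i
  predecessor? i with Fin.any? (λ j → nextEqual? j i)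
  ... | yes found = inj₁ found
  ... | no none   = inj₂ λ j next → none (j , next)

  -- The predecessor is the largest element of the fibre below b; the search climbs from a as long
  -- as some element of the fibre lies strictly between.
  predecessor : ∀ {a b} → a < b → f a ≡ f b → ∃[ j ] NextEqual f j b
  predecessor {a} {b} = go (Fin.>-wellFounded a)
    where
    go : ∀ {a} → Acc (λ i j → j < i) a → a < b → f a ≡ f b → ∃[ j ] NextEqual f j b
    go {a} (acc rs) a<b fa≡fb with Fin.any? (λ k → a Fin.<? k ×-dec k Fin.<? b ×-dec f k Fin.≟ f b)
    ... | yes (k , a<k , k<b , fk≡fb) = go (rs a<k) k<b fk≡fb
    ... | no none = a , a<b , fa≡fb , λ k a<k fa≡fk →
      ℕ.≮⇒≥ λ k<b → none (k , a<k , k<b , trans (sym fa≡fk) fa≡fb)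

  First-unique : ∀ {a b} → First a → First b → f a ≡ f b → a ≡ b
  First-unique {a} {b} first-a first-b fa≡fb with Fin.<-cmp a b
  ... | tri< a<b _ _ = let (j , next) = predecessor a<b fa≡fb in contradiction next (first-b j)
  ... | tri≈ _ a≡b _ = a≡b
  ... | tri> _ _ b<a = let (j , next) = predecessor b<a (sym fa≡fb) in contradiction next (first-a j)

  first : ∀ i → ∃[ a ] First a × f a ≡ f i
  first i = go (Fin.<-wellFounded i)
    where
    go : ∀ {i} → Acc _<_ i → ∃[ a ] First a × f a ≡ f i
    go {i} (acc rs) with predecessor? i
    ... | inj₂ first-i = i , first-i , refl
    ... | inj₁ (j , j<i , fj≡fi , _) = let (a , first-a , fa≡fj) = go (rs j<i) in
      a , first-a , trans fa≡fj fj≡fi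

-- Queue orders

-- The laws common to both directions: `σ-queue` extracts them from a region and `Queue-exists`
-- obtains them from the parking condition. The law `fifo` says that the pairs `NextEqual`, drawn as
-- arcs over the word, do not nest.
record Queue {n} (f : Fin n → Fin n) (w : Permutation′ n) : Set where
  field
    starts  : ∀ {i} → First f i → f i ≡ w ⟨$⟩ˡ i
    forward : ∀ {i j} → NextEqual f i j → w ⟨$⟩ˡ i < w ⟨$⟩ˡ j
    fifo    : ∀ {i j k l} → NextEqual f i l → NextEqual f j k →
              w ⟨$⟩ˡ i < w ⟨$⟩ˡ j → w ⟨$⟩ˡ l < w ⟨$⟩ˡ k

-- By strong induction the words agree before p. If either entry at p is the least of its fibre, its
-- value p fixes it in both words. Otherwise both entries have predecessors before p. If these
-- differed, `fifo` in the word whose entry at p has the later predecessor would put the other entry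
-- before p, where the words agree, although that entry stands at p in its own word.
Queue-unique : ∀ {n} {f : Fin n → Fin n} {w v} → Queue f w → Queue f v → ∀ i → w ⟨$⟩ˡ i ≡ v ⟨$⟩ˡ i
Queue-unique {n} {f} {w} {v} W V i =
  trans (sym (inverseˡ v)) (cong (v ⟨$⟩ˡ_) (trans (sym (entries (w ⟨$⟩ˡ i))) (inverseʳ w)))
  where
  open Queue
  entries : ∀ p → w ⟨$⟩ʳ p ≡ v ⟨$⟩ʳ p
  entries p = go (Fin.<-wellFounded p)
    where
    go : ∀ {p} → Acc _<_ p → w ⟨$⟩ʳ p ≡ v ⟨$⟩ʳ p
    go {p} (acc rs) = compare
      where
      a = w ⟨$⟩ʳ p
      b = v ⟨$⟩ʳ p
      posʷ-a : w ⟨$⟩ˡ a ≡ p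
      posʷ-a = inverseˡ w
      posᵛ-b : v ⟨$⟩ˡ b ≡ p
      posᵛ-b = inverseˡ v

      agreeʷ : ∀ {i} → w ⟨$⟩ˡ i < p → v ⟨$⟩ˡ i ≡ w ⟨$⟩ˡ i
      agreeʷ {i} lt = trans (cong (v ⟨$⟩ˡ_) (trans (sym (inverseʳ w)) (go (rs lt)))) (inverseˡ v)
      agreeᵛ : ∀ {i} → v ⟨$⟩ˡ i < p → w ⟨$⟩ˡ i ≡ v ⟨$⟩ˡ i
      agreeᵛ {i} lt = trans (cong (w ⟨$⟩ˡ_) (trans (sym (inverseʳ v)) (sym (go (rs lt))))) (inverseˡ w)

      compare : a ≡ b
      compare with predecessor? f a | predecessor? f b
      ... | inj₂ first-a | _ =
        position-injective v (trans (sym (starts V first-a)) (trans (starts W first-a) (trans posʷ-a (sym posᵛ-b))))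
      ... | inj₁ _ | inj₂ first-b =
        position-injective w (trans posʷ-a (trans (sym posᵛ-b) (trans (sym (starts V first-b)) (starts W first-b))))
      ... | inj₁ (c , next-c) | inj₁ (d , next-d) = cmp (Fin.<-cmp (w ⟨$⟩ˡ c) (v ⟨$⟩ˡ d))
        where
        c<p : w ⟨$⟩ˡ c < p
        c<p = subst (w ⟨$⟩ˡ c <_) posʷ-a (forward W next-c)
        d<p : v ⟨$⟩ˡ d < p
        d<p = subst (v ⟨$⟩ˡ d <_) posᵛ-b (forward V next-d)
        cmp : B.Tri (w ⟨$⟩ˡ c < v ⟨$⟩ˡ d) (w ⟨$⟩ˡ c ≡ v ⟨$⟩ˡ d) (v ⟨$⟩ˡ d < w ⟨$⟩ˡ c) → a ≡ b
        cmp (tri< c<d _ _) =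
          let a<p = subst (v ⟨$⟩ˡ a <_) posᵛ-b (fifo V next-c next-d (subst (_< v ⟨$⟩ˡ d) (sym (agreeʷ c<p)) c<d))
          in contradiction a<p (Fin.<-irrefl (trans (sym (agreeᵛ a<p)) posʷ-a))
        cmp (tri≈ _ eq _) with refl ← position-injective w (trans eq (sym (agreeᵛ d<p))) =
          NextEqual-functional f next-c next-d
        cmp (tri> _ _ d<c) =
          let b<p = subst (w ⟨$⟩ˡ b <_) posʷ-a (fifo W next-d next-c (subst (_< w ⟨$⟩ˡ c) (sym (agreeᵛ d<p)) d<c))
          in contradiction b<p (Fin.<-irrefl (trans (sym (agreeʷ b<p)) posᵛ-b))

-- Building sequences step by step

AgreeBelow : ∀ {A : Set} → ℕ → (ℕ → A) → (ℕ → A) → Set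
AgreeBelow p u v = ∀ r → r ℕ.< p → u r ≡ v r

module _ {A : Set} (P : (ℕ → A) → ℕ → Set) (N : ℕ)
  (local : ∀ {u v p} → AgreeBelow (suc p) u v → P u p → P v p)
  (extend : ∀ u p → p ℕ.< N → (∀ r → r ℕ.< p → P u r) →
            ∃[ a ] ∀ v → AgreeBelow p u v → v p ≡ a → P v p)
  (default : A) where

  -- Sequences are total, and only the entries chosen so far are meaningful; `default` fills the
  -- rest. As functions are compared pointwise, `extend` must validate every v that agrees with u
  -- below p, and `local` keeps earlier conclusions valid when later entries are overwritten.
  stepwise : ∃[ u ] ∀ p → p ℕ.< N → P u p
  stepwise = go N ℕ.≤-refl
    where
    go : ∀ m → m ℕ.≤ N → ∃[ u ] ∀ p → p ℕ.< m → P u p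
    go zero    _   = (λ _ → default) , λ _ ()
    go (suc m) m<N = v , holds
      where
      u = proj₁ (go m (ℕ.<⇒≤ m<N))
      u-holds = proj₂ (go m (ℕ.<⇒≤ m<N))
      a = proj₁ (extend u m m<N u-holds)
      v : ℕ → A
      v r with r ℕ.≟ m
      ... | yes _ = a
      ... | no  _ = u r
      v-below : AgreeBelow m u v
      v-below r r<m with r ℕ.≟ m
      ... | yes refl = contradiction r<m (ℕ.<-irrefl refl)
      ... | no _     = refl
      v-at : v m ≡ a
      v-at with m ℕ.≟ m
      ... | yes _  = refl
      ... | no m≢m = contradiction refl m≢m
      holds : ∀ p → p ℕ.< suc m → P v p
      holds p p≤m with ℕ.m≤n⇒m<n∨m≡n (ℕ.≤-pred p≤m)
      ... | inj₁ p<m  = local (λ r r≤p → v-below r (ℕ.<-≤-trans r≤p p<m)) (u-holds p p<m)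
      ... | inj₂ refl = proj₂ (extend u m m<N u-holds) v v-below v-at

least : ∀ {P : Pred ℕ 0ℓ} → Decidable P → ∀ {s} → P s →
        ∃[ t ] t ℕ.≤ s × P t × (∀ r → r ℕ.< t → ¬ P r)
least {P} P? {s} = go (ℕ.<-wellFounded s)
  where
  go : ∀ {s} → Acc ℕ._<_ s → P s → ∃[ t ] t ℕ.≤ s × P t × (∀ r → r ℕ.< t → ¬ P r)
  go {s} (acc rs) Ps with ℕ.anyUpTo? P? s
  ... | yes (r , r<s , Pr) = let (t , t≤r , rest) = go (rs r<s) Pr in t , ℕ.≤-trans t≤r (ℕ.<⇒≤ r<s) , rest
  ... | no none = s , ℕ.≤-refl , Ps , λ r r<s Pr → none (r , r<s , Pr)

-- The queue order of a parking function

module _ {n} (f : Fin n → Fin n) (parking : IsParkingFunction f) where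

  private
    Seq : Set
    Seq = ℕ → Fin n

    Placed : Seq → ℕ → Fin n → Set
    Placed w p i = ∃[ r ] r ℕ.< p × w r ≡ i

    placed? : ∀ w p i → Dec (Placed w p i)
    placed? w p i = ℕ.anyUpTo? (λ r → w r Fin.≟ i) p

    Opens : Seq → ℕ → Set
    Opens w p = toℕ (f (w p)) ≡ p × First f (w p)

    -- The first clause ensures that a position which is a value of f can only be filled by the
    -- start of a fibre, as `waiting` requires; the last clause is `fifo` seen from position p.
    Closes : Seq → ℕ → Set
    Closes w p = (∀ i → toℕ (f i) ≢ p) × ∃[ s ] s ℕ.< p × NextEqual f (w s) (w p) ×
      (∀ r → r ℕ.< s → ∀ k → NextEqual f (w r) k → Placed w p k)

    Valid : Seq → ℕ → Set
    Valid w p = ¬ Placed w p (w p) × (Opens w p ⊎ Closes w p)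

    placed-resp : ∀ {u v p i} → AgreeBelow p u v → Placed u p i → Placed v p i
    placed-resp agree (r , r<p , eq) = r , r<p , trans (sym (agree r r<p)) eq

    agree-sym : ∀ {u v : Seq} {p} → AgreeBelow p u v → AgreeBelow p v u
    agree-sym agree r r<p = sym (agree r r<p)

    valid-local : ∀ {u v p} → AgreeBelow (suc p) u v → Valid u p → Valid v p
    valid-local {u} {v} {p} agree (fresh , kind) = fresh′ , kind′ kind
      where
      agree< : AgreeBelow p u v
      agree< r r<p = agree r (ℕ.m<n⇒m<1+n r<p)
      at-p : u p ≡ v p
      at-p = agree p (ℕ.n<1+n p)
      fresh′ : ¬ Placed v p (v p)
      fresh′ placed = fresh (subst (Placed u p) (sym at-p) (placed-resp (agree-sym agree<) placed))
      kind′ : Opens u p ⊎ Closes u p → Opens v p ⊎ Closes v p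
      kind′ (inj₁ opens) = inj₁ (subst (λ i → toℕ (f i) ≡ p × First f i) at-p opens)
      kind′ (inj₂ (not-value , s , s<p , next , earlier)) = inj₂ (not-value , s , s<p ,
        subst₂ (NextEqual f) (agree< s s<p) at-p next ,
        λ r r<s k next′ → placed-resp agree<
          (earlier r r<s k (subst (λ i → NextEqual f i k) (sym (agree< r (ℕ.<-trans r<s s<p))) next′)))

    -- Only p elements are placed, while at least p + 1 elements have a value at most p.
    unplaced : ∀ w p → p ℕ.< n → ∃[ i ] toℕ (f i) ℕ.≤ p × ¬ Placed w p i
    unplaced w p p<n with Fin.any? (λ i → toℕ (f i) ℕ.≤? p ×-dec ¬? (placed? w p i))
    ... | yes found = found
    ... | no none = contradiction
      (ℕ.≤-trans (parking (suc p) (ℕ.s≤s ℕ.z≤n) p<n)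
        (count≤ (λ i → toℕ (f i) ℕ.<? suc p) (λ i lt → fromℕ< (proj₁ (proj₂ (pos i lt)))) pos-inj))
      (ℕ.<-irrefl refl)
      where
      pos : ∀ i → toℕ (f i) ℕ.< suc p → Placed w p i
      pos i (ℕ.s≤s fi≤p) with placed? w p i
      ... | yes placed = placed
      ... | no ¬placed = contradiction (i , fi≤p , ¬placed) none
      pos-inj : ∀ {i j} lt lt′ →
        fromℕ< (proj₁ (proj₂ (pos i lt))) ≡ fromℕ< (proj₁ (proj₂ (pos j lt′))) → i ≡ j
      pos-inj {i} {j} lt lt′ eq = trans (sym (proj₂ (proj₂ (pos i lt))))
        (trans (cong w (Fin.fromℕ<-injective _ _ _ _ eq)) (proj₂ (proj₂ (pos j lt′))))

    Waiting : Seq → ℕ → ℕ → Set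
    Waiting w p s = s ℕ.< p × ∃[ k ] NextEqual f (w s) k × ¬ Placed w p k

    waiting? : ∀ w p s → Dec (Waiting w p s)
    waiting? w p s = s ℕ.<? p ×-dec Fin.any? (λ k → nextEqual? f (w s) k ×-dec ¬? (placed? w p k))

    -- Descend the fibre from i. A placed predecessor of an unplaced element is waiting; an unplaced
    -- one continues the descent. The descent cannot end at the least element, because that was
    -- placed at position f i, which lies before p.
    waiting : ∀ w p → (∀ r → r ℕ.< p → Valid w r) →
              ∀ i → toℕ (f i) ℕ.< p → ¬ Placed w p i → ∃[ s ] Waiting w p s
    waiting w p valid i = go (Fin.<-wellFounded i)
      where
      go : ∀ {i} → Acc _<_ i → toℕ (f i) ℕ.< p → ¬ Placed w p i → ∃[ s ] Waiting w p s
      go {i} (acc rs) fi<p ¬placed with predecessor? f i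
      ... | inj₁ (j , next@(j<i , fj≡fi , _)) with placed? w p j
      ...   | yes (s , s<p , refl) = s , s<p , i , next , ¬placed
      ...   | no ¬placed-j = go (rs j<i) (subst (λ v → toℕ v ℕ.< p) (sym fj≡fi) fi<p) ¬placed-j
      go {i} _ fi<p ¬placed | inj₂ first-i with proj₂ (valid (toℕ (f i)) fi<p)
      ... | inj₁ (value , first-w) = contradiction
        (toℕ (f i) , fi<p , First-unique f first-w first-i (Fin.toℕ-injective value)) ¬placed
      ... | inj₂ (not-value , _) = contradiction refl (not-value i)

    place : ∀ w p → p ℕ.< n → (∀ r → r ℕ.< p → Valid w r) →
            ∃[ a ] ∀ v → AgreeBelow p w v → v p ≡ a → Valid v p
    place w p p<n valid with Fin.any? (λ i → toℕ (f i) ℕ.≟ p)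
    ... | yes (i , fi≡p) = a , λ v agree vp≡a →
      (λ placed → fresh v agree (subst (Placed v p) vp≡a placed)) ,
      inj₁ (subst (λ i → toℕ (f i) ≡ p × First f i) (sym vp≡a) (fa≡p , first-a))
      where
      a = proj₁ (first f i)
      first-a = proj₁ (proj₂ (first f i))
      fa≡p : toℕ (f a) ≡ p
      fa≡p = trans (cong toℕ (proj₂ (proj₂ (first f i)))) fi≡p
      -- If a already stood at some r < p, then either it opened there, whence r = f a = p, or it
      -- closed there and has a predecessor; both are impossible.
      fresh : ∀ v → AgreeBelow p w v → ¬ Placed v p a
      fresh v agree placed with placed-resp (agree-sym agree) placed
      ... | r , r<p , wr≡a with proj₂ (valid r r<p)
      ...   | inj₁ (value , _) =
              ℕ.<-irrefl (trans (sym value) (trans (cong (toℕ ∘ f) wr≡a) fa≡p)) r<p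
      ...   | inj₂ (_ , s , _ , next , _) = first-a (w s) (subst (NextEqual f (w s)) wr≡a next)
    ... | no none =
      let (i , fi≤p , ¬placed) = unplaced w p p<n
          -- `unplaced` admits the value p, but p is not a value in this branch.
          fi<p = ℕ.≤∧≢⇒< fi≤p (λ eq → none (i , eq))
          (_ , wait) = waiting w p valid i fi<p ¬placed
          (s , _ , (s<p , k , next , fresh) , minimal) = least (waiting? w p) wait
      in k , λ v agree vp≡k →
           (λ placed → fresh (placed-resp (agree-sym agree) (subst (Placed v p) vp≡k placed))) ,
           inj₂ ((λ i eq → none (i , eq)) , s , s<p ,
             subst₂ (NextEqual f) (agree s s<p) (sym vp≡k) next ,
             λ r r<s l next′ → placed-resp agree (served w p s r l minimal r<s (ℕ.<-trans r<s s<p)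
               (subst (λ i → NextEqual f i l) (sym (agree r (ℕ.<-trans r<s s<p))) next′)))
      where
      served : ∀ w p s r l → (∀ r → r ℕ.< s → ¬ Waiting w p r) → r ℕ.< s → r ℕ.< p →
               NextEqual f (w r) l → Placed w p l
      served w p s r l minimal r<s r<p next with placed? w p l
      ... | yes placed = placed
      ... | no ¬placed = contradiction (r<p , l , next , ¬placed) (minimal r r<s)

  Queue-exists : Fin n → ∃[ w ] Queue f w
  Queue-exists default = π , record { starts = starts′ ; forward = forward′ ; fifo = fifo′ }
    where
    built = stepwise Valid n valid-local place default
    w = proj₁ built
    valid = proj₂ built

    entry : Fin n → Fin n
    entry p = w (toℕ p)
    entry-injective : Injective _≡_ _≡_ entry
    entry-injective {p} {q} eq with Fin.<-cmp p q
    ... | tri< p<q _ _ = contradiction (toℕ p , p<q , eq) (proj₁ (valid (toℕ q) (Fin.toℕ<n q)))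
    ... | tri≈ _ p≡q _ = p≡q
    ... | tri> _ _ q<p = contradiction (toℕ q , q<p , sym eq) (proj₁ (valid (toℕ p) (Fin.toℕ<n p)))
    π = injective⇒permutation entry entry-injective

    pos : Fin n → Fin n
    pos i = π ⟨$⟩ˡ i
    w-pos : ∀ i → w (toℕ (pos i)) ≡ i
    w-pos i = inverseʳ π
    pos-w : ∀ {r i} → r ℕ.< n → w r ≡ i → toℕ (pos i) ≡ r
    pos-w {r} r<n refl = trans (cong toℕ (entry-injective
      (trans (w-pos (w r)) (cong w (sym (Fin.toℕ-fromℕ< r<n)))))) (Fin.toℕ-fromℕ< r<n)

    kind : ∀ i → Opens w (toℕ (pos i)) ⊎ Closes w (toℕ (pos i))
    kind i = proj₂ (valid (toℕ (pos i)) (Fin.toℕ<n (pos i)))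

    starts′ : ∀ {i} → First f i → f i ≡ pos i
    starts′ {i} first-i with kind i
    ... | inj₁ (value , _) = Fin.toℕ-injective (trans (cong (toℕ ∘ f) (sym (w-pos i))) value)
    ... | inj₂ (_ , s , _ , next , _) = contradiction (subst (NextEqual f (w s)) (w-pos i) next) (first-i (w s))

    -- An element with a predecessor was not placed by `Opens`, and since predecessors are unique,
    -- the recorded s is the position of j.
    closes : ∀ {j k} → NextEqual f j k → toℕ (pos j) ℕ.< toℕ (pos k) ×
      (∀ r → r ℕ.< toℕ (pos j) → ∀ l → NextEqual f (w r) l → Placed w (toℕ (pos k)) l)
    closes {j} {k} next with kind k
    ... | inj₁ (_ , first-k) = contradiction (subst (NextEqual f j) (sym (w-pos k)) next) (first-k j)
    ... | inj₂ (_ , s , s<k , next′ , earlier) =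
      subst (ℕ._< toℕ (pos k)) (sym pos-j) s<k , λ r r<j → earlier r (subst (r ℕ.<_) pos-j r<j)
      where
      pos-j : toℕ (pos j) ≡ s
      pos-j = pos-w (ℕ.<-trans s<k (Fin.toℕ<n (pos k)))
        (NextEqual-injective f (subst (NextEqual f (w s)) (w-pos k) next′) next)

    forward′ : ∀ {i j} → NextEqual f i j → pos i < pos j
    forward′ next = proj₁ (closes next)

    fifo′ : ∀ {i j k l} → NextEqual f i l → NextEqual f j k → pos i < pos j → pos l < pos k
    fifo′ {i} {j} {k} {l} next-i next-j i<j =
      let (r , r<k , wr≡l) = proj₂ (closes next-j) (toℕ (pos i)) i<j l
                               (subst (λ i → NextEqual f i l) (sym (w-pos i)) next-i)
      in subst (ℕ._< toℕ (pos k)) (sym (pos-w (ℕ.<-trans r<k (Fin.toℕ<n (pos k))) wr≡l)) r<k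

-- Realising a semiorder by rationals

p-1<p : ∀ p → p ℚ.- 1ℚ ℚ.< p
p-1<p p = linear₁ 0<1 (solve 1 (λ p → p :- (p :- con 1ℚ) := con 1ℚ :- con 0ℚ) refl p)

p<p+1 : ∀ p → p ℚ.< p ℚ.+ 1ℚ
p<p+1 p = linear₁ 0<1 (solve 1 (λ p → (p :+ con 1ℚ) :- p := con 1ℚ :- con 0ℚ) refl p)

below-all : ∀ us → ∃[ v ] All (v ℚ.<_) us
below-all []       = 0ℚ , []
below-all (u ∷ us) with below-all us
... | v , v<us with v ℚ.<? u
...   | yes v<u = v , v<u ∷ v<us
...   | no v≮u  = u ℚ.- 1ℚ , p-1<p u ∷
        All.map (ℚ.<-trans (ℚ.<-≤-trans (p-1<p u) (ℚ.≮⇒≥ v≮u))) v<us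

squeeze : ∀ l us → All (l ℚ.<_) us → ∃[ v ] l ℚ.< v × All (v ℚ.<_) us
squeeze l []       []           = l ℚ.+ 1ℚ , p<p+1 l , []
squeeze l (u ∷ us) (l<u ∷ l<us) with squeeze l us l<us
... | v , l<v , v<us with v ℚ.<? u
...   | yes v<u = v , l<v , v<u ∷ v<us
...   | no v≮u  = let (m , l<m , m<u) = ℚ.<-dense l<u in
        m , l<m , m<u ∷ All.map (ℚ.<-trans (ℚ.<-≤-trans m<u (ℚ.≮⇒≥ v≮u))) v<us

-- Pairwise compatible bounds suffice on a line. If the new lower bound l reaches v, a point
-- squeezed between l and all upper bounds exceeds v and hence still exceeds the older lower bounds.
between : ∀ ls us → All (λ l → All (l ℚ.<_) us) ls →
          ∃[ v ] All (ℚ._< v) ls × All (v ℚ.<_) us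
between []       us []           = let (v , v<us) = below-all us in v , [] , v<us
between (l ∷ ls) us (l<us ∷ lts) with between ls us lts
... | v , ls<v , v<us with l ℚ.<? v
...   | yes l<v = v , l<v ∷ ls<v , v<us
...   | no l≮v  = let (m , l<m , m<us) = squeeze l us l<us in
        m , l<m ∷ All.map (λ k<v → ℚ.<-trans (ℚ.<-≤-trans k<v (ℚ.≮⇒≥ l≮v)) l<m) ls<v , m<us

-- Both alternatives are strict, so that no difference equals 1; only earlier positions are
-- mentioned, as the stepwise construction demands.
Realises : (ℕ → ℕ → Set) → (ℕ → ℚ) → ℕ → Set
Realises Far y p = ∀ r → r ℕ.< p → y p ℚ.< y r ×
  (Far r p → y p ℚ.+ 1ℚ ℚ.< y r) × (¬ Far r p → y r ℚ.< y p ℚ.+ 1ℚ)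

module _ {Far : ℕ → ℕ → Set} (far? : ∀ r p → Dec (Far r p))
  (widen : ∀ {r r′ p p′} → r′ ℕ.≤ r → p ℕ.≤ p′ → Far r p → Far r′ p′) where

  private
    realises-local : ∀ {u v p} → AgreeBelow (suc p) u v → Realises Far u p → Realises Far v p
    realises-local {u} {v} {p} agree real r r<p =
      subst₂ (λ a b → b ℚ.< a × (Far r p → b ℚ.+ 1ℚ ℚ.< a) × (¬ Far r p → a ℚ.< b ℚ.+ 1ℚ))
        (agree r (ℕ.m<n⇒m<1+n r<p)) (agree p (ℕ.n<1+n p)) (real r r<p)

    place : ∀ N (y : ℕ → ℚ) p → p ℕ.< N → (∀ r → r ℕ.< p → Realises Far y r) →
            ∃[ a ] ∀ z → AgreeBelow p y z → z p ≡ a → Realises Far z p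
    place N y p _ real = v , λ z agree zp≡v r r<p →
      subst₂ (λ a b → b ℚ.< a × (Far r p → b ℚ.+ 1ℚ ℚ.< a) × (¬ Far r p → a ℚ.< b ℚ.+ 1ℚ))
        (agree r r<p) (sym zp≡v)
        ( All.lookup v<us (∈-++⁺ˡ (∈-map⁺ y (∈-upTo⁺ r<p)))
        , (λ far → linear₁ (All.lookup v<us (∈-++⁺ʳ (map y (upTo p))
              (∈-map⁺ (λ r → y r ℚ.- 1ℚ) (∈-filter⁺ (λ r → far? r p) (∈-upTo⁺ r<p) far))))
            (solve 2 (λ a v → a :- (v :+ con 1ℚ) := (a :- con 1ℚ) :- v) refl (y r) v))
        , λ near → linear₁ (All.lookup ls<v
              (∈-map⁺ (λ r → y r ℚ.- 1ℚ) (∈-filter⁺ (λ r → ¬? (far? r p)) (∈-upTo⁺ r<p) near)))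
            (solve 2 (λ a v → (v :+ con 1ℚ) :- a := v :- (a :- con 1ℚ)) refl (y r) v))
      where
      -- Each requirement on the new value is solved for it: near positions bound it from below, the
      -- order and the far positions from above.
      ls us₁ us₂ us : List ℚ
      ls = map (λ r → y r ℚ.- 1ℚ) (filter (λ r → ¬? (far? r p)) (upTo p))
      us₁ = map y (upTo p)
      us₂ = map (λ r → y r ℚ.- 1ℚ) (filter (λ r → far? r p) (upTo p))
      us = us₁ ++ us₂

      decreasing : ∀ {r s} → r ℕ.< s → s ℕ.< p → y s ℚ.< y r
      decreasing {r} {s} r<s s<p = proj₁ (real s s<p r r<s)

      -- For r < s, nearness of r to p passes to s by the contrapositive of `widen`, which gives y r
      -- < y s + 1. Otherwise y r is at most y s.
      low<high : ∀ {r s} → r ℕ.< p → ¬ Far r p → s ℕ.< p → y r ℚ.- 1ℚ ℚ.< y s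
      low<high {r} {s} r<p near s<p with ℕ.<-cmp r s
      ... | tri< r<s _ _ = linear₁
              (proj₂ (proj₂ (real s s<p r r<s)) λ far → near (widen ℕ.≤-refl (ℕ.<⇒≤ s<p) far))
              (solve 2 (λ a b → b :- (a :- con 1ℚ) := (b :+ con 1ℚ) :- a) refl (y r) (y s))
      ... | tri≈ _ refl _ = p-1<p (y r)
      ... | tri> _ _ s<r = ℚ.<-trans (p-1<p (y r)) (decreasing s<r r<p)

      -- A far s with r at or before it would make r far by `widen`, so s precedes r.
      low<far : ∀ {r s} → ¬ Far r p → s ℕ.< p → Far s p → r ℕ.< p → y r ℚ.- 1ℚ ℚ.< y s ℚ.- 1ℚ
      low<far {r} {s} near s<p far r<p with s ℕ.<? r
      ... | yes s<r = ℚ.+-monoˡ-< (ℚ.- 1ℚ) (decreasing s<r r<p)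
      ... | no s≮r  = contradiction (widen (ℕ.≮⇒≥ s≮r) ℕ.≤-refl far) near

      pairwise : ∀ {l u} → l ∈ˡ ls → u ∈ˡ us → l ℚ.< u
      pairwise l∈ u∈ with ∈-map⁻ (λ r → y r ℚ.- 1ℚ) l∈ | ∈-++⁻ us₁ u∈
      ... | r , r∈ , refl | inj₁ u∈₁ with ∈-filter⁻ (λ r → ¬? (far? r p)) r∈ | ∈-map⁻ y u∈₁
      ...   | r∈upTo , near | s , s∈ , refl = low<high (∈-upTo⁻ r∈upTo) near (∈-upTo⁻ s∈)
      pairwise l∈ u∈ | r , r∈ , refl | inj₂ u∈₂
        with ∈-filter⁻ (λ r → ¬? (far? r p)) r∈ | ∈-map⁻ (λ r → y r ℚ.- 1ℚ) u∈₂
      ... | r∈upTo , near | s , s∈ , refl with ∈-filter⁻ (λ r → far? r p) s∈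
      ...   | s∈upTo , far = low<far near (∈-upTo⁻ s∈upTo) far (∈-upTo⁻ r∈upTo)

      chosen = between ls us (All.tabulate λ l∈ → All.tabulate λ u∈ → pairwise l∈ u∈)
      v = proj₁ chosen
      ls<v = proj₁ (proj₂ chosen)
      v<us = proj₂ (proj₂ chosen)

  opaque
    realise : ∀ N → ∃[ y ] ∀ p → p ℕ.< N → Realises Far y p
    realise N = stepwise (Realises Far) N realises-local (place N) 0ℚ

-- Regions

module _ {n} (G : SimpleGraph n) (R : Region (𝒮 G)) where

  private
    x  = proj₁ R
    x∈ : x ∈ Complement (𝒮 G)
    x∈ = proj₂ R

  point∈region : x ∈ points R
  point∈region = Setoid.refl (regionSetoid (𝒮 G)) {R}

  coordinates-connex : ∀ {i j} → i ≢ j → x i <ℝ x j ⊎ x j <ℝ x i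
  coordinates-connex {i} {j} i≢j with Fin.<-cmp i j
  ... | tri≈ _ i≡j _ = contradiction i≡j i≢j
  ... | tri< i<j _ _ with x∈ (braid i<j)
  ...   | inj₁ lt = inj₁ (x-y<0⇒x<y {x i} {x j} lt)
  ...   | inj₂ gt = inj₂ (0<x-y⇒y<x {x i} {x j} gt)
  coordinates-connex {i} {j} i≢j | tri> _ _ j<i with x∈ (braid j<i)
  ...   | inj₁ lt = inj₂ (x-y<0⇒x<y {x j} {x i} lt)
  ...   | inj₂ gt = inj₁ (0<x-y⇒y<x {x j} {x i} gt)

  <-holdsOnRegion : ∀ {i j} → x j <ℝ x i → HoldsOnRegion G R (λ y → y j <ℝ y i)
  <-holdsOnRegion {i} {j} xj<xi y y∈ with Fin.<-cmp i j
  ... | tri< i<j _ _ = 0<x-y⇒y<x {y i} {y j}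
        (proj₂ (component⇒sameSide {x = x} {y} y∈ (braid i<j)) (y<x⇒0<x-y {x i} {x j} xj<xi))
  ... | tri≈ _ refl _ = contradiction xj<xi (<ℝ-asym {x j} {x i} xj<xi)
  ... | tri> _ _ j<i = x-y<0⇒x<y {y j} {y i}
        (proj₁ (component⇒sameSide {x = x} {y} y∈ (braid j<i)) (x<y⇒x-y<0 {x j} {x i} xj<xi))

  arc⁺ : ∀ {i j} → i < j → Adj G i j → 1ℝ <ℝ x i - x j → Arc G R i j
  arc⁺ i<j adj gt = i<j , adj , λ y y∈ → proj₂ (component⇒sameSide {x = x} {y} y∈ (shi i<j adj)) gt

  arc⁻ : ∀ {i j} → Arc G R i j → 1ℝ <ℝ x i - x j
  arc⁻ (_ , _ , holds) = holds x point∈region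

  arc? : ∀ i j → Dec (Arc G R i j)
  arc? i j with i Fin.<? j | adj? G i j
  ... | no i≮j  | _       = no (i≮j ∘ proj₁)
  ... | yes _   | no ¬adj = no (¬adj ∘ proj₁ ∘ proj₂)
  ... | yes i<j | yes adj with x∈ (shi i<j adj)
  ...   | inj₁ lt = no λ arc → <ℝ-asym {x i - x j} {1ℝ} lt (arc⁻ arc)
  ...   | inj₂ gt = yes (arc⁺ i<j adj gt)

  sorted-exists : Σ[ w ∈ Permutation′ n ] SortedBy G R w
  sorted-exists = w , λ p q p<q → <-holdsOnRegion {w ⟨$⟩ʳ p} {w ⟨$⟩ʳ q} (decreasing p q p<q)
    where
    w,mono : Σ[ w ∈ Permutation′ n ] (∀ {i j} → x j <ℝ x i → w ⟨$⟩ˡ i < w ⟨$⟩ˡ j)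
    w,mono = sorting {_≺_ = λ i j → x j <ℝ x i}
      (λ {i} {j} {k} xj<xi xk<xj → <ℝ-trans {x k} {x j} {x i} xk<xj xj<xi)
      (λ {i} lt → <ℝ-asym {x i} {x i} lt lt)
      (λ {i} {j} i≢j → coordinates-connex {j} {i} (i≢j ∘ sym))
    w = proj₁ w,mono
    decreasing : ∀ p q → p < q → x (w ⟨$⟩ʳ q) <ℝ x (w ⟨$⟩ʳ p)
    decreasing p q p<q = [ id , (λ gt → contradiction
        (subst₂ _<_ (inverseˡ w) (inverseˡ w) (proj₂ w,mono {w ⟨$⟩ʳ q} {w ⟨$⟩ʳ p} gt)) (ℕ.<⇒≯ p<q)) ]′
      (coordinates-connex {w ⟨$⟩ʳ q} {w ⟨$⟩ʳ p} λ eq → Fin.<-irrefl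
        (trans (sym (inverseˡ w)) (trans (cong (w ⟨$⟩ˡ_) (sym eq)) (inverseˡ w))) p<q)

  -- Chains

  module _ (w : Permutation′ n) (sorted : SortedBy G R w) where

    private
      pos : Fin n → Fin n
      pos i = w ⟨$⟩ˡ i

    sorted⁺ : ∀ {i j} → pos i < pos j → x j <ℝ x i
    sorted⁺ {i} {j} lt = subst₂ (λ a b → x a <ℝ x b) (inverseʳ w) (inverseʳ w)
      (sorted (pos i) (pos j) lt x point∈region)

    sorted⁻ : ∀ {i j} → x j <ℝ x i → pos i < pos j
    sorted⁻ {i} {j} xj<xi with Fin.<-cmp (pos i) (pos j)
    ... | tri< lt _ _ = lt
    ... | tri≈ _ eq _ with refl ← position-injective w {i} {j} eq =
          contradiction xj<xi (<ℝ-asym {x i} {x i} xj<xi)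
    ... | tri> _ _ gt = contradiction (sorted⁺ gt) (<ℝ-asym {x j} {x i} xj<xi)

    arc-forward : ∀ {i j} → Arc G R i j → pos i < pos j
    arc-forward {i} {j} arc = sorted⁻ (1<x-y⇒y<x {x i} {x j} (arc⁻ arc))

    arc-widen : ∀ {i j k l} → Arc G R j k → WeaklyLeft G R w i j → WeaklyLeft G R w k l →
                i < l → Adj G i l → Arc G R i l
    arc-widen {i} {j} {k} {l} arc i≤j k≤l i<l adj = arc⁺ i<l adj (right (left (arc⁻ arc)))
      where
      left : 1ℝ <ℝ x j - x k → 1ℝ <ℝ x i - x k
      left gt with Fin.<-cmp (pos i) (pos j)
      ... | tri< lt _ _ = <-minus-monoˡ {1ℝ} {x j} {x i} {x k} gt (sorted⁺ lt)
      ... | tri≈ _ eq _ = subst (λ a → 1ℝ <ℝ x a - x k) (position-injective w (sym eq)) gt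
      ... | tri> _ _ j<i = contradiction i≤j (ℕ.<⇒≱ j<i)
      right : 1ℝ <ℝ x i - x k → 1ℝ <ℝ x i - x l
      right gt with Fin.<-cmp (pos k) (pos l)
      ... | tri< lt _ _ = <-minus-monoʳ {1ℝ} {x i} {x l} {x k} gt (sorted⁺ lt)
      ... | tri≈ _ eq _ = subst (λ a → 1ℝ <ℝ x i - x a) (position-injective w eq) gt
      ... | tri> _ _ l<k = contradiction k≤l (ℕ.<⇒≱ l<k)

    private
      A = Arc G R
      M = RemainingArc G R w

    removed? : ∀ i l → Dec (Removed G R w i l)
    removed? i l = Fin.any? λ j → Fin.any? λ k → arc? j k ×-dec
      ¬? (≡-dec Fin._≟_ Fin._≟_ (j , k) (i , l)) ×-dec pos i Fin.≤? pos j ×-dec pos k Fin.≤? pos l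

    remaining? : ∀ i l → Dec (M i l)
    remaining? i l = arc? i l ×-dec ¬? (removed? i l)

    -- Of two arcs leaving i, the longer contains the shorter and is removed.
    remaining-functional : ∀ {i j k} → M i j → M i k → j ≡ k
    remaining-functional {i} {j} {k} (ij , ¬rij) (ik , ¬rik) with j Fin.≟ k
    ... | yes j≡k = j≡k
    ... | no j≢k with position-connex w j≢k
    ...   | inj₁ lt = contradiction (i , j , ij , j≢k ∘ ,-injectiveʳ , ℕ.≤-refl , ℕ.<⇒≤ lt) ¬rik
    ...   | inj₂ gt = contradiction (i , k , ik , j≢k ∘ sym ∘ ,-injectiveʳ , ℕ.≤-refl , ℕ.<⇒≤ gt) ¬rij

    remaining-injective : ∀ {i j k} → M i k → M j k → i ≡ j
    remaining-injective {i} {j} {k} (ik , ¬rik) (jk , ¬rjk) with i Fin.≟ j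
    ... | yes i≡j = i≡j
    ... | no i≢j with position-connex w i≢j
    ...   | inj₁ lt = contradiction (j , k , jk , i≢j ∘ sym ∘ ,-injectiveˡ , ℕ.<⇒≤ lt , ℕ.≤-refl) ¬rik
    ...   | inj₂ gt = contradiction (i , k , ik , i≢j ∘ ,-injectiveˡ , ℕ.<⇒≤ gt , ℕ.≤-refl) ¬rjk

    remaining-fifo : ∀ {i j k l} → M i l → M j k → pos i < pos j → pos l < pos k
    remaining-fifo {i} {j} {k} {l} (_ , ¬ril) (jk , _) i<j = ℕ.≰⇒> λ k≤l →
      ¬ril (j , k , jk , (λ eq → Fin.<-irrefl (cong pos (sym (,-injectiveˡ eq))) i<j) , ℕ.<⇒≤ i<j , k≤l)

    -- A removed arc contains a different arc, whose interval is strictly shorter because positions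
    -- determine elements. The argument d of `go` bounds the length and decreases at each such
    -- passage.
    innermost : ∀ {i l} → A i l → ∃[ j ] ∃[ k ] M j k × WeaklyLeft G R w i j × WeaklyLeft G R w k l
    innermost {i} {l} = go (toℕ (pos l)) (ℕ.m≤n+m (toℕ (pos l)) (toℕ (pos i)))
      where
      go : ∀ d {i l} → toℕ (pos l) ℕ.≤ toℕ (pos i) ℕ.+ d → A i l →
           ∃[ j ] ∃[ k ] M j k × WeaklyLeft G R w i j × WeaklyLeft G R w k l
      go zero {i} {l} l≤i+0 arc = contradiction
        (ℕ.≤-trans l≤i+0 (ℕ.≤-reflexive (ℕ.+-identityʳ (toℕ (pos i))))) (ℕ.<⇒≱ (arc-forward arc))
      go (suc d) {i} {l} l≤i+d arc with removed? i l
      ... | no ¬removed = i , l , (arc , ¬removed) , ℕ.≤-refl , ℕ.≤-refl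
      ... | yes (j , k , jk , jk≢il , i≤j , k≤l) =
        let (j′ , k′ , M′ , j≤j′ , k′≤k) = go d shorter jk in
        j′ , k′ , M′ , ℕ.≤-trans i≤j j≤j′ , ℕ.≤-trans k′≤k k≤l
        where
        l≤1+i+d : toℕ (pos l) ℕ.≤ suc (toℕ (pos i) ℕ.+ d)
        l≤1+i+d = ℕ.≤-trans l≤i+d (ℕ.≤-reflexive (ℕ.+-suc (toℕ (pos i)) d))
        shorter : toℕ (pos k) ℕ.≤ toℕ (pos j) ℕ.+ d
        shorter with ℕ.m≤n⇒m<n∨m≡n i≤j | ℕ.m≤n⇒m<n∨m≡n k≤l
        ... | inj₁ i<j | _ = ℕ.≤-trans k≤l (ℕ.≤-trans l≤1+i+d (ℕ.+-monoˡ-≤ d i<j))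
        ... | inj₂ _ | inj₁ k<l = ℕ.≤-trans (ℕ.≤-pred (ℕ.≤-trans k<l l≤1+i+d)) (ℕ.+-monoˡ-≤ d i≤j)
        ... | inj₂ i≡j | inj₂ k≡l = contradiction
          (cong₂ _,_ (position-injective w (Fin.toℕ-injective (sym i≡j)))
                     (position-injective w (Fin.toℕ-injective k≡l))) jk≢il

    path-≤ : ∀ {i j} → Star M i j → i Fin.≤ j
    path-≤ stop                     = ℕ.≤-refl
    path-≤ (((i<k , _) , _) ◅ p) = ℕ.≤-trans (ℕ.<⇒≤ i<k) (path-≤ p)

    path-weaklyLeft : ∀ {i j} → Star M i j → WeaklyLeft G R w i j
    path-weaklyLeft stop             = ℕ.≤-refl
    path-weaklyLeft ((arc , _) ◅ p) = ℕ.≤-trans (ℕ.<⇒≤ (arc-forward arc)) (path-weaklyLeft p)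

    -- At most one remaining arc ends at k, so a nonempty path to k enters it from i.
    path-retract : ∀ {i j k} → Star M j k → M i k → j ≡ k ⊎ Star M j i
    path-retract stop       ik = inj₁ refl
    path-retract (jm ◅ p) ik with path-retract p ik
    ... | inj₁ refl with refl ← remaining-injective jm ik = inj₂ stop
    ... | inj₂ q = inj₂ (jm ◅ q)

    -- With at most one arc into and one out of each element, every zigzag straightens: a turn
    -- retraces the arc just used. Chains are therefore directed paths, and any two of their
    -- elements are comparable.
    sameChain⇒path : ∀ {i j} → SameChain G R w i j → Star M i j ⊎ Star M j i
    sameChain⇒path stop = inj₁ stop
    sameChain⇒path (fwd ik ◅ c) with sameChain⇒path c
    ... | inj₁ p = inj₁ (ik ◅ p)
    ... | inj₂ p with path-retract p ik
    ...   | inj₁ refl = inj₁ (ik ◅ stop)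
    ...   | inj₂ q    = inj₂ q
    sameChain⇒path (bwd ki ◅ c) with sameChain⇒path c
    ... | inj₁ stop = inj₂ (ki ◅ stop)
    ... | inj₁ (km ◅ p) with refl ← remaining-functional ki km = inj₁ p
    ... | inj₂ p = inj₂ (p ◅◅ (ki ◅ stop))

    path⇒sameChain : ∀ {i j} → Star M i j → SameChain G R w i j
    path⇒sameChain stop        = stop
    path⇒sameChain (ik ◅ p) = fwd ik ◅ path⇒sameChain p

    sameChain-sym : ∀ {i j} → SameChain G R w i j → SameChain G R w j i
    sameChain-sym = Eq.symmetric M

    path-to-source : ∀ {k m} → (∀ j → ¬ M j m) → Star M k m → k ≡ m
    path-to-source source stop = refl
    path-to-source source (kj ◅ p) with refl ← path-to-source source p = contradiction kj (source _)

    chain-source : ∀ i → ∃[ m ] Star M m i × (∀ j → ¬ M j m)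
    chain-source i = go (Fin.<-wellFounded i)
      where
      go : ∀ {i} → Acc _<_ i → ∃[ m ] Star M m i × (∀ j → ¬ M j m)
      go {i} (acc rs) with Fin.any? (λ j → remaining? j i)
      ... | no none = i , stop , λ j ji → none (j , ji)
      ... | yes (j , ji@((j<i , _) , _)) = let (m , p , source) = go (rs j<i) in m , p ◅◅ (ji ◅ stop) , source

    source-leftmost : ∀ {i m} → Star M m i → (∀ j → ¬ M j m) → LeftmostInChain G R w i m
    source-leftmost {i} {m} p source = sameChain-sym (path⇒sameChain p) , λ k ik → left k (path⇒sameChain p ◅◅ ik)
      where
      left : ∀ k → SameChain G R w m k → WeaklyLeft G R w m k
      left k mk with sameChain⇒path mk
      ... | inj₁ q = path-weaklyLeft q
      ... | inj₂ q = ℕ.≤-reflexive (cong (toℕ ∘ pos) (sym (path-to-source source q)))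

    leftmost-unique : ∀ {i j m m′} → SameChain G R w i j →
      LeftmostInChain G R w i m → LeftmostInChain G R w j m′ → m ≡ m′
    leftmost-unique ij (im , m-left) (jm′ , m′-left) = position-injective w (Fin.≤-antisym
      (m-left _ (ij ◅◅ jm′)) (m′-left _ (sameChain-sym ij ◅◅ im)))

    -- The function attached to a region

    module _ {f : Fin n → Fin n} (leftmost : ∀ i → ∃[ m ] LeftmostInChain G R w i m × f i ≡ w ⟨$⟩ˡ m) where

      sameChain⇒≡ : ∀ {i j} → SameChain G R w i j → f i ≡ f j
      sameChain⇒≡ {i} {j} ij with leftmost i | leftmost j
      ... | m , i-m , fi≡ | m′ , j-m′ , fj≡ =
        trans fi≡ (trans (cong pos (leftmost-unique ij i-m j-m′)) (sym fj≡))

      ≡⇒sameChain : ∀ {i j} → f i ≡ f j → SameChain G R w i j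
      ≡⇒sameChain {i} {j} fi≡fj with leftmost i | leftmost j
      ... | m , (im , _) , fi≡ | m′ , (jm′ , _) , fj≡
        with refl ← position-injective w (trans (sym fi≡) (trans fi≡fj fj≡)) = im ◅◅ sameChain-sym jm′

      -- Elements with equal values share a chain, so a path leads from i to j, its direction being
      -- forced by i < j. The first stop k of the path has the same value, so minimality gives j at
      -- most k, while paths increase.
      nextEqual⇒remaining : ∀ {i j} → NextEqual f i j → M i j
      nextEqual⇒remaining {i} {j} (i<j , fi≡fj , j-min) with sameChain⇒path (≡⇒sameChain fi≡fj)
      ... | inj₁ stop = contradiction i<j (ℕ.<-irrefl refl)
      ... | inj₁ (_◅_ {j = k} ik@((i<k , _) , _) p) = subst (M i)
            (Fin.≤-antisym (path-≤ p) (j-min k i<k (sameChain⇒≡ (fwd ik ◅ stop)))) ik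
      ... | inj₂ p = contradiction i<j (ℕ.≤⇒≯ (path-≤ p))

      remaining⇒nextEqual : ∀ {i j} → M i j → NextEqual f i j
      remaining⇒nextEqual {i} {j} ij@((i<j , _) , _) = i<j , sameChain⇒≡ (fwd ij ◅ stop) , minimal
        where
        minimal : ∀ k → i < k → f i ≡ f k → j Fin.≤ k
        minimal k i<k fi≡fk with sameChain⇒path (≡⇒sameChain fi≡fk)
        ... | inj₁ stop = contradiction i<k (ℕ.<-irrefl refl)
        ... | inj₁ (im ◅ p) with refl ← remaining-functional ij im = path-≤ p
        ... | inj₂ p = contradiction i<k (ℕ.≤⇒≯ (path-≤ p))

      value≤position : ∀ i → f i Fin.≤ pos i
      value≤position i with leftmost i
      ... | m , (_ , m-left) , fi≡ = subst (Fin._≤ pos i) (sym fi≡) (m-left i stop)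

      source-value : ∀ {i} → (∀ j → ¬ M j i) → f i ≡ pos i
      source-value {i} source with leftmost i
      ... | m , i-m , fi≡ = trans fi≡ (cong pos (leftmost-unique stop i-m (source-leftmost stop source)))

      σ-queue : Queue f w
      σ-queue = record
        { starts  = λ first-i → source-value λ j ji → first-i j (remaining⇒nextEqual ji)
        ; forward = λ next → arc-forward (proj₁ (nextEqual⇒remaining next))
        ; fifo    = λ next next′ → remaining-fifo (nextEqual⇒remaining next) (nextEqual⇒remaining next′)
        }

      -- A value is the leftmost position of a chain, hence at most the position of each member. So
      -- the first j entries of the word have values among the first j.
      σ-parking : IsParkingFunction f
      σ-parking j _ j≤n = count≥ (λ i → toℕ (f i) ℕ.<? j) entry entry-injective value<
        where
        inj : Fin j → Fin n
        inj r = Fin.inject≤ r j≤n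
        entry : Fin j → Fin n
        entry r = w ⟨$⟩ʳ inj r
        pos-entry : ∀ r → pos (entry r) ≡ inj r
        pos-entry r = inverseˡ w
        entry-injective : ∀ {r s} → entry r ≡ entry s → r ≡ s
        entry-injective {r} {s} eq = Fin.inject≤-injective j≤n j≤n r s
          (trans (sym (pos-entry r)) (trans (cong pos eq) (pos-entry s)))
        value< : ∀ r → toℕ (f (entry r)) ℕ.< j
        value< r = ℕ.≤-<-trans (value≤position (entry r))
          (subst (ℕ._< j) (sym (trans (cong toℕ (pos-entry r)) (Fin.toℕ-inject≤ r j≤n))) (Fin.toℕ<n r))

      σ-compatible : Compatible G f
      σ-compatible i j next = proj₁ (proj₂ (proj₁ (nextEqual⇒remaining next)))

-- The map σ

module _ {n} (G : SimpleGraph n) where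

  private
    module 𝓡 = Setoid (regionSetoid (𝒮 G))

    ≈-sym : ∀ R S → R 𝓡.≈ S → S 𝓡.≈ R
    ≈-sym R S = 𝓡.sym {R} {S}

  -- Independence of the point that represents a region

  positions-resp : ∀ R S → R 𝓡.≈ S → ∀ {w v} → SortedBy G R w → SortedBy G S v →
                   ∀ i → w ⟨$⟩ˡ i ≡ v ⟨$⟩ˡ i
  positions-resp R S R≈S {w} {v} sorted-w sorted-v = positions-unique w v
    (λ {i} {j} lt → sorted⁻ G S v sorted-v
      (<-holdsOnRegion G R {i} {j} (sorted⁺ G R w sorted-w lt) (proj₁ S) R≈S))
    (λ {i} {j} lt → sorted⁻ G R w sorted-w
      (<-holdsOnRegion G S {i} {j} (sorted⁺ G S v sorted-v lt) (proj₁ R) (≈-sym R S R≈S)))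

  arc-resp : ∀ R S → R 𝓡.≈ S → ∀ {i j} → Arc G R i j → Arc G S i j
  arc-resp R S R≈S (i<j , adj , holds) = arc⁺ G S i<j adj (holds (proj₁ S) R≈S)

  removed-resp : ∀ R S → R 𝓡.≈ S → ∀ {w v} → (∀ i → w ⟨$⟩ˡ i ≡ v ⟨$⟩ˡ i) →
                 ∀ {i l} → Removed G R w i l → Removed G S v i l
  removed-resp R S R≈S eq {i} {l} (j , k , jk , ≢ , i≤j , k≤l) =
    j , k , arc-resp R S R≈S jk , ≢ , subst₂ Fin._≤_ (eq i) (eq j) i≤j , subst₂ Fin._≤_ (eq k) (eq l) k≤l

  remaining-resp : ∀ R S → R 𝓡.≈ S → ∀ {w v} → (∀ i → w ⟨$⟩ˡ i ≡ v ⟨$⟩ˡ i) →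
                   ∀ {i l} → RemainingArc G R w i l → RemainingArc G S v i l
  remaining-resp R S R≈S {w} {v} eq (arc , ¬removed) = arc-resp R S R≈S arc ,
    ¬removed ∘ removed-resp S R (≈-sym R S R≈S) {v} {w} (sym ∘ eq)

  leftmost-resp : ∀ R S → R 𝓡.≈ S → ∀ {w v} → (∀ i → w ⟨$⟩ˡ i ≡ v ⟨$⟩ˡ i) →
                  ∀ {i m} → LeftmostInChain G R w i m → LeftmostInChain G S v i m
  leftmost-resp R S R≈S {w} {v} eq {i} {m} (im , left) =
    Eq.map (remaining-resp R S R≈S {w} {v} eq) im ,
    λ k ik → subst₂ Fin._≤_ (eq m) (eq k)
      (left k (Eq.map (remaining-resp S R (≈-sym R S R≈S) {v} {w} (sym ∘ eq)) ik))

  σ-functional : ∀ R S → R 𝓡.≈ S → ∀ {f g} → σ-Graph G R f → σ-Graph G S g → f ≗ g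
  σ-functional R S R≈S (w , sorted-w , leftmost-w) (v , sorted-v , leftmost-v) i
    with leftmost-w i | leftmost-v i
  ... | m , im , fi≡ | m′ , im′ , gi≡ = trans fi≡ (trans (pos≡ m) (trans
    (cong (v ⟨$⟩ˡ_) (leftmost-unique G S v sorted-v stop (leftmost-resp R S R≈S {w} {v} pos≡ im) im′)) (sym gi≡)))
    where
    pos≡ : ∀ i → w ⟨$⟩ˡ i ≡ v ⟨$⟩ˡ i
    pos≡ = positions-resp R S R≈S {w} {v} sorted-w sorted-v

  σ-resp-≗ : ∀ R {f g} → f ≗ g → σ-Graph G R f → σ-Graph G R g
  σ-resp-≗ R f≗g (w , sorted , leftmost) = w , sorted , λ i →
    let (m , im , fi≡) = leftmost i in m , im , trans (sym (f≗g i)) fi≡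

  opaque
    σ-total : ∀ R → ∃[ f ] σ-Graph G R f
    σ-total R =
      let (w , sorted) = sorted-exists G R
          source = chain-source G R w sorted
      in (λ i → w ⟨$⟩ˡ proj₁ (source i)) , w , sorted , λ i →
         let (m , p , m-source) = source i in m , source-leftmost G R w sorted p m-source , refl

  σ-injective : ∀ R S {f} → σ-Graph G R f → σ-Graph G S f → R 𝓡.≈ S
  σ-injective R@(x , x∈) S@(y , y∈) {f} (w , sorted-w , leftmost-w) (v , sorted-v , leftmost-v) =
    sameSide⇒component x∈ same
    where
    pos≡ : ∀ i → w ⟨$⟩ˡ i ≡ v ⟨$⟩ˡ i
    pos≡ = Queue-unique (σ-queue G R w sorted-w leftmost-w) (σ-queue G S v sorted-v leftmost-v)

    order : ∀ {i j} → x j <ℝ x i → y j <ℝ y i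
    order {i} {j} lt = sorted⁺ G S v sorted-v (subst₂ _<_ (pos≡ i) (pos≡ j) (sorted⁻ G R w sorted-w lt))

    arc⇒ : ∀ {i l} → Arc G R i l → Arc G S i l
    arc⇒ {i} {l} arc@(i<l , adj , _) =
      let (j , k , jk , i≤j , k≤l) = innermost G R w sorted-w arc
          -- The regions share only f, so a remaining arc passes from R to S as a pair
          -- `NextEqual f`.
          jk′ = nextEqual⇒remaining G S v sorted-v leftmost-v (remaining⇒nextEqual G R w sorted-w leftmost-w jk)
      in arc-widen G S v sorted-v (proj₁ jk′)
           (subst₂ Fin._≤_ (pos≡ i) (pos≡ j) i≤j) (subst₂ Fin._≤_ (pos≡ k) (pos≡ l) k≤l) i<l adj

    arc⇐ : ∀ {i l} → Arc G S i l → Arc G R i l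
    arc⇐ {i} {l} arc@(i<l , adj , _) =
      let (j , k , jk , i≤j , k≤l) = innermost G S v sorted-v arc
          jk′ = nextEqual⇒remaining G R w sorted-w leftmost-w (remaining⇒nextEqual G S v sorted-v leftmost-v jk)
      in arc-widen G R w sorted-w (proj₁ jk′)
           (subst₂ Fin._≤_ (sym (pos≡ i)) (sym (pos≡ j)) i≤j) (subst₂ Fin._≤_ (sym (pos≡ k)) (sym (pos≡ l)) k≤l) i<l adj

    same : SameSide (𝒮 G) x y
    same (braid {i} {j} i<j) =
      (λ lt → x<y⇒x-y<0 {y i} {y j} (order (x-y<0⇒x<y {x i} {x j} lt))) ,
      (λ gt → y<x⇒0<x-y {y i} {y j} (order (0<x-y⇒y<x {x i} {x j} gt)))
    same (shi {i} {j} i<j adj) =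
      -- A difference below 1 is the absence of an arc: `y∈` offers two sides for y, and the wrong
      -- one would give R an arc by `arc⇐`.
      (λ lt → [ id , (λ gt → contradiction (arc⁻ G R (arc⇐ (arc⁺ G S i<j adj gt))) (<ℝ-asym {x i - x j} {1ℝ} lt)) ]′
        (y∈ (shi i<j adj))) ,
      (λ gt → arc⁻ G S (arc⇒ (arc⁺ G R i<j adj gt)))

  -- The region of a queue order

  module _ {f : Fin n → Fin n} (compatible : Compatible G f) {w} (queue : Queue f w) where

    open Queue queue

    private
      pos : Fin n → Fin n
      pos i = w ⟨$⟩ˡ i

      -- The smallest relation that contains the pairs `NextEqual` and is closed under widening. It
      -- is imposed on all positions alike; for a pair not adjacent in G no hyperplane at distance 1
      -- records the choice.
      Far : ℕ → ℕ → Set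
      Far r p = ∃[ i ] ∃[ l ] NextEqual f i l × r ℕ.≤ toℕ (pos i) × toℕ (pos l) ℕ.≤ p

      far? : ∀ r p → Dec (Far r p)
      far? r p = Fin.any? λ i → Fin.any? λ l →
        nextEqual? f i l ×-dec r ℕ.≤? toℕ (pos i) ×-dec toℕ (pos l) ℕ.≤? p

      far-widen : ∀ {r r′ p p′} → r′ ℕ.≤ r → p ℕ.≤ p′ → Far r p → Far r′ p′
      far-widen r′≤r p≤p′ (i , l , next , r≤i , l≤p) =
        i , l , next , ℕ.≤-trans r′≤r r≤i , ℕ.≤-trans l≤p p≤p′

      realisation : ∃[ y ] ∀ p → p ℕ.< n → Realises Far y p
      realisation = realise far? far-widen n

      y : Fin n → ℚ
      y i = proj₁ realisation (toℕ (pos i))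

      y-real : ∀ {i j} → pos i < pos j → y j ℚ.< y i ×
        (Far (toℕ (pos i)) (toℕ (pos j)) → y j ℚ.+ 1ℚ ℚ.< y i) ×
        (¬ Far (toℕ (pos i)) (toℕ (pos j)) → y i ℚ.< y j ℚ.+ 1ℚ)
      y-real {i} {j} = proj₂ realisation (toℕ (pos j)) (Fin.toℕ<n (pos j)) (toℕ (pos i))

      x : ℝ^ n
      x i = fromℚ (y i)

      x-decreasing : ∀ {i j} → pos i < pos j → x j <ℝ x i
      x-decreasing lt = fromℚ-mono (proj₁ (y-real lt))

      far⇒>1 : ∀ {i j} → pos i < pos j → Far (toℕ (pos i)) (toℕ (pos j)) → 1ℝ <ℝ x i - x j
      far⇒>1 {i} {j} lt far = fromℚ-mono {1ℚ} {y i ℚ.- y j} (linear₁ (proj₁ (proj₂ (y-real lt)) far)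
        (solve 2 (λ a b → (a :- b) :- con 1ℚ := a :- (b :+ con 1ℚ)) refl (y i) (y j)))

      near⇒<1 : ∀ {i j} → pos i < pos j → ¬ Far (toℕ (pos i)) (toℕ (pos j)) → x i - x j <ℝ 1ℝ
      near⇒<1 {i} {j} lt near = fromℚ-mono {y i ℚ.- y j} {1ℚ} (linear₁ (proj₂ (proj₂ (y-real lt)) near)
        (solve 2 (λ a b → con 1ℚ :- (a :- b) := (b :+ con 1ℚ) :- a) refl (y i) (y j)))

      opaque
        x∈ : x ∈ Complement (𝒮 G)
        x∈ (braid {i} {j} i<j) with position-connex w (Fin.<⇒≢ i<j)
        ... | inj₁ lt = inj₂ (y<x⇒0<x-y {x i} {x j} (x-decreasing lt))
        ... | inj₂ gt = inj₁ (x<y⇒x-y<0 {x i} {x j} (x-decreasing gt))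
        x∈ (shi {i} {j} i<j _) with position-connex w (Fin.<⇒≢ i<j)
        ... | inj₂ gt = inj₁ (<ℝ-trans {x i - x j} {0ℝ} {1ℝ} (x<y⇒x-y<0 {x i} {x j} (x-decreasing gt)) 0ℝ<1ℝ)
        ... | inj₁ lt with far? (toℕ (pos i)) (toℕ (pos j))
        ...   | yes far = inj₂ (far⇒>1 lt far)
        ...   | no near = inj₁ (near⇒<1 lt near)

    queueRegion : Region (𝒮 G)
    queueRegion = x , x∈

    private
      R = queueRegion

      sorted : SortedBy G R w
      sorted p q p<q = <-holdsOnRegion G R {w ⟨$⟩ʳ p} {w ⟨$⟩ʳ q}
        (x-decreasing (subst₂ _<_ (sym (inverseˡ w)) (sym (inverseˡ w)) p<q))

      arc⇒far : ∀ {i l} → Arc G R i l → Far (toℕ (pos i)) (toℕ (pos l))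
      arc⇒far {i} {l} arc with far? (toℕ (pos i)) (toℕ (pos l))
      ... | yes far = far
      ... | no near = contradiction (arc⁻ G R arc)
        (<ℝ-asym {x i - x l} {1ℝ} (near⇒<1 (arc-forward G R w sorted arc) near))

      -- Here compatibility enters: it supplies the edge that turns a distance above 1 into an arc.
      next⇒arc : ∀ {i l} → NextEqual f i l → Arc G R i l
      next⇒arc {i} {l} next@(i<l , _) = arc⁺ G R i<l (compatible i l next)
        (far⇒>1 (forward next) (i , l , next , ℕ.≤-refl , ℕ.≤-refl))

      next-unnested : ∀ {i j k l} → NextEqual f i l → NextEqual f j k →
                      pos i Fin.≤ pos j → pos k Fin.≤ pos l → i ≡ j × k ≡ l
      next-unnested next-il next-jk i≤j k≤l with ℕ.m≤n⇒m<n∨m≡n i≤j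
      ... | inj₁ i<j = contradiction k≤l (ℕ.<⇒≱ (fifo next-il next-jk i<j))
      ... | inj₂ i≡j with refl ← position-injective w (Fin.toℕ-injective i≡j) =
            refl , NextEqual-functional f next-jk next-il

      -- An arc inside (i , l) contains a `NextEqual` pair, which by non-nesting is (i , l) itself;
      -- squeezed in between, the arc equals (i , l) as well.
      next⇒remaining : ∀ {i l} → NextEqual f i l → RemainingArc G R w i l
      next⇒remaining {i} {l} next = next⇒arc next , λ (j , k , jk , jk≢il , i≤j , k≤l) →
        let (i′ , l′ , next′ , j≤i′ , l′≤k) = arc⇒far jk
            (i≡i′ , l′≡l) = next-unnested next next′ (ℕ.≤-trans i≤j j≤i′) (ℕ.≤-trans l′≤k k≤l)
        in jk≢il (cong₂ _,_
             (position-injective w (Fin.≤-antisym (subst (λ a → pos j Fin.≤ pos a) (sym i≡i′) j≤i′) i≤j))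
             (position-injective w (Fin.≤-antisym k≤l (subst (λ a → pos a Fin.≤ pos k) l′≡l l′≤k))))

      remaining⇒next : ∀ {i l} → RemainingArc G R w i l → NextEqual f i l
      remaining⇒next {i} {l} (arc , ¬removed) with arc⇒far arc
      ... | j , k , next , i≤j , k≤l with ≡-dec Fin._≟_ Fin._≟_ (j , k) (i , l)
      ...   | yes refl   = next
      ...   | no jk≢il = contradiction (j , k , next⇒arc next , jk≢il , i≤j , k≤l) ¬removed

      path-≡ : ∀ {i j} → Star (RemainingArc G R w) i j → f i ≡ f j
      path-≡ stop        = refl
      path-≡ (ik ◅ p) = trans (proj₁ (proj₂ (remaining⇒next ik))) (path-≡ p)

    σ-queueRegion : σ-Graph G queueRegion f
    σ-queueRegion = w , sorted , λ i →
      let (m , p , source) = chain-source G R w sorted i in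
      m , source-leftmost G R w sorted p source ,
      trans (sym (path-≡ p)) (starts λ j next → source j (next⇒remaining next))

opaque
  σ-surjective : ∀ {n} (G : SimpleGraph n) → 1 ℕ.≤ n → (f : ParkingFunction G) →
                 ∃[ R ] σ-Graph G R (proj₁ f)
  σ-surjective G 1≤n (f , parking , compatible) =
    -- Any element of `Fin n` serves as the filler of the sequence outside its first n positions.
    let (w , queue) = Queue-exists f parking (fromℕ< 1≤n) in
    queueRegion G compatible queue , σ-queueRegion G compatible queue

theorem3p1 : ∀ (n : ℕ) → 1 ≤ n → (G : SimpleGraph n) →
    Σ[ φ ∈ Bijection (regionSetoid (𝒮 G)) (parkingSetoid G) ]
    (∀ (R : Region (𝒮 G)) (f : Fin n → Fin n) →
    σ-Graph G R f ⇔ (f ≗ proj₁ (Bijection.to φ R)))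
theorem3p1 n 1≤n G = φ , λ R f → mk⇔
  (λ graph → σ-functional G R R (point∈region G R) graph (σ-graph R))
  (λ f≗ → σ-resp-≗ G R (sym ∘ f≗) (σ-graph R))
  where
  σ : Region (𝒮 G) → Fin n → Fin n
  σ R = proj₁ (σ-total G R)

  σ-graph : ∀ R → σ-Graph G R (σ R)
  σ-graph R = proj₂ (σ-total G R)

  σ-value : Region (𝒮 G) → ParkingFunction G
  σ-value R = let (w , sorted , leftmost) = σ-graph R in
    σ R , σ-parking G R w sorted leftmost , σ-compatible G R w sorted leftmost

  φ : Bijection (regionSetoid (𝒮 G)) (parkingSetoid G)
  φ = record
    { to        = σ-value
    ; cong      = λ {R} {S} R≈S → σ-functional G R S R≈S (σ-graph R) (σ-graph S)
    ; bijective =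
        (λ {R} {S} σR≗σS → σ-injective G R S (σ-resp-≗ G R σR≗σS (σ-graph R)) (σ-graph S)) ,
        λ f → let (R , graph) = σ-surjective G 1≤n f in
          R , λ {S} S≈R → σ-functional G S R S≈R (σ-graph S) graph
    }
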